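{- Let $k$ be an odd integer with $k\ge 5$, let $D$ be a strong $k$-quasi-transitive digraph with $\mathrm{diam}(D)\ge k+2$, let $u,v\in V(D)$ with $d(u,v)=k+2$, and let $P$ be a shortest $(u,v)$-path in $D$. Then $D[V(D)\setminus V(P)]$ is either a semicomplete digraph, a semicomplete bipartite digraph, or an empty digraph.
   Context: All digraphs are finite, without loops or multiple arcs (opposite arcs allowed). Vertices $x,y$ are adjacent if $xy$ or $yx$ is an arc. For $k\ge 2$, $D$ is $k$-quasi-transitive if for every path $x_0x_1\ldots x_k$ of length $k$, $x_0$ and $x_k$ are adjacent. $d(x,y)$ is the length of a shortest $(x,y)$-path, $\mathrm{diam}(D)=\max_{x,y}d(x,y)$. $D[S]$ is the induced subdigraph. A semicomplete digraph: every two distinct vertices adjacent. A semicomplete bipartite digraph: there is a bipartition $(X,Y)$ of the vertex set with no arcs inside $X$ or $Y$ and every vertex of $X$ adjacent to every vertex of $Y$. An empty digraph is one with no arcs. -}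

module Defs where

open import Data.Nat.Base using (ℕ; zero; suc; _≤_)
open import Data.Product.Base using (Σ-syntax; ∃-syntax; _×_)
open import Data.Refinement using (Refinement-syntax; value)
open import Data.Sum.Base using (_⊎_)
open import Data.Vec.Base using (Vec; []; _∷_)
open import Data.Vec.Membership.Propositional using () renaming (_∈_ to _∈ᵛ_)
open import Data.Vec.Relation.Unary.Unique.Propositional using (Unique)
open import Level using (0ℓ)
open import Relation.Binary.Core using (Rel)
open import Relation.Binary.Definitions using (Decidable)
open import Relation.Binary.PropositionalEquality using (_≢_)
open import Relation.Nullary.Negation using (¬_)
open import Relation.Unary using (Pred; _∈_)

-- A finite digraph is, up to isomorphism, a `Digraph (Fin n)`.  The vertex type
-- is left general so that an induced subdigraph is again a digraph.  Multiple
-- arcs are excluded because only the existence of an arc x → y is ever used;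
-- decidability makes the arc set a genuine (finite) set.
record Digraph (V : Set) : Set₁ where
  field
    Arc      : Rel V 0ℓ
    arc?     : Decidable Arc
    loopless : ∀ x → ¬ Arc x x

  Adjacent : Rel V 0ℓ
  Adjacent x y = Arc x y ⊎ Arc y x

open Digraph public

private
  variable
    V : Set

module _ (D : Digraph V) where

  data Walk : V → V → ℕ → Set where
    [_]  : ∀ x → Walk x x zero
    _∷_  : ∀ {x y z ℓ} → Arc D x y → Walk y z ℓ → Walk x z (suc ℓ)

  vertices : ∀ {x y ℓ} → Walk x y ℓ → Vec V (suc ℓ)
  vertices [ x ]             = x ∷ []
  vertices (_∷_ {x = x} _ w) = x ∷ vertices w

  record Path (x y : V) (ℓ : ℕ) : Set where
    constructor path
    field
      walk   : Walk x y ℓ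
      unique : Unique (vertices walk)

  Strong : Set
  Strong = ∀ x y → ∃[ ℓ ] Path x y ℓ

  QuasiTransitive : ℕ → Set
  QuasiTransitive k = ∀ {x y} → Path x y k → Adjacent D x y

  IsShortest : ∀ {x y ℓ} → Path x y ℓ → Set
  IsShortest {x} {y} {ℓ} _ = ∀ {m} → Path x y m → ℓ ≤ m

  -- d(x,y) = d
  IsDistance : V → V → ℕ → Set
  IsDistance x y d = Σ[ P ∈ Path x y d ] IsShortest P

  -- diam(D) = m.  Pairs with no path between them impose no bound here, so this
  -- is the diameter only when D is strong.
  IsDiameter : ℕ → Set
  IsDiameter m = (∃[ x ] ∃[ y ] IsDistance x y m)
               × (∀ {x y d} → IsDistance x y d → d ≤ m)

  VertexSet : ∀ {x y ℓ} → Path x y ℓ → Pred V 0ℓ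
  VertexSet P z = z ∈ᵛ vertices (Path.walk P)

  -- Membership proofs in a refinement type are irrelevant, so two vertices of
  -- the induced subdigraph are equal as soon as they are equal in V.
  induced : (S : Pred V 0ℓ) → Digraph [ x ∈ V ∣ x ∈ S ]
  induced S = record
    { Arc      = λ x y → Arc D (value x) (value y)
    ; arc?     = λ x y → arc? D (value x) (value y)
    ; loopless = λ x → loopless D (value x)
    }

Semicomplete : Digraph V → Set
Semicomplete D = ∀ x y → x ≢ y → Adjacent D x y

record SemicompleteBipartite (D : Digraph V) : Set₁ where
  field
    X Y         : Pred V 0ℓ
    cover       : ∀ v → v ∈ X ⊎ v ∈ Y
    disjoint    : ∀ {v} → v ∈ X → ¬ v ∈ Y
    noArcInX    : ∀ {x y} → x ∈ X → y ∈ X → ¬ Arc D x y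
    noArcInY    : ∀ {x y} → x ∈ Y → y ∈ Y → ¬ Arc D x y
    allAdjacent : ∀ {x y} → x ∈ X → y ∈ Y → Adjacent D x y

Empty : Digraph V → Set
Empty D = ∀ x y → ¬ Arc D x y

{-# OPTIONS --safe #-}
module Submission where

-- Let N = k + 2 and let x_0 … x_N be the shortest path.  A path leaving a vertex z into x_i and
-- continuing along the path and its backward chords with k arcs in total makes z adjacent to its end;
-- hence z is adjacent to every x_j with j < i and j ≡ i mod 2, and every vertex off the path is
-- adjacent to path vertices of at least one parity.  No arcs x_a → z → x_b with b > a + 2 exist.
-- Two nonadjacent vertices of opposite parities would either both send no arc to the path or both
-- receive none; following a shortest exit from (or entry to) the nearer one excludes this.
-- If some vertex off the path has both parities, it yields arcs x_{b+k-2} → z → x_b, and a detour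
-- through them gives every vertex both parities, so all are adjacent.  Otherwise the two parities
-- are the sides of a semicomplete bipartite digraph, since an arc between vertices of equal parity
-- would produce a vertex with both.  Reversing all arcs maps x_i to x_{N-i}, which halves the work.

open import Data.Empty using (⊥; ⊥-elim; ⊥-elim-irr)
open import Data.Fin.Base using (Fin)
import Data.Fin.Properties as Fin
open import Data.Irrelevant using ([_])
open import Data.List.Base using () renaming ([] to []ˡ; _∷_ to _∷ˡ_)
open import Data.Nat.Base using (ℕ; zero; suc; _+_; _∸_; _≤_; _<_; z≤n; s≤s)
open import Data.Nat.Divisibility using (_∤_; divides)
open import Data.Nat.Properties
open import Data.Nat.Tactic.RingSolver using (solve)
open import Data.Product.Base using (∃-syntax; _×_; _,_; proj₁; proj₂)
open import Data.Refinement using (Refinement; _,_; value; value-injective)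
open import Data.Sum.Base using (_⊎_; inj₁; inj₂; [_,_]′; swap)
open import Data.Vec.Base using (Vec; []; _∷_; _++_)
open import Data.Vec.Membership.DecPropositional using (_∈?_)
open import Data.Vec.Membership.Propositional using () renaming (_∈_ to _∈ᵛ_)
open import Data.Vec.Relation.Unary.All as All using (All; []; _∷_)
import Data.Vec.Relation.Unary.All.Properties as All
open import Data.Vec.Relation.Unary.AllPairs using ([]; _∷_)
open import Data.Vec.Relation.Unary.AllPairs.Properties using (++⁺)
open import Data.Vec.Relation.Unary.Any using (here; there)
open import Data.Vec.Relation.Unary.Unique.Propositional using (Unique)
open import Function.Base using (_∋_)
open import Relation.Binary.PropositionalEquality
open import Relation.Nullary using (¬_; Dec; yes; no; ¬?; _×-dec_; _⊎-dec_)
open import Relation.Unary using (∁)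
open import Defs

-- The arc x_N → x_0 closes the path to a cycle of length k + 3, which is even since k is odd. So
-- going a fixed number of arcs round it changes the parity of the index in a fixed way, even across
-- the wrap; this is why parities organise the proof. A pair x_{b+k-2} → z → x_b breaks the
-- invariant: with x_b ... x_{b+k-2} it closes a cycle of odd length k, and an arc between another
-- vertex and this cycle can be prolonged by k - 1 arcs round it, ending next to where it started.
-- Quasi-transitivity yields adjacencies without directions. Directions come mainly from the path
-- being shortest: x_a → z → x_b forces b ≤ a + 2. For k = 5 this bound is sometimes attained, and
-- the cases it leaves open need separate arguments. A further obstacle is that a vertex may have no
-- arc to the path, or be far from it. Then the path of length k follows a shortest exit, whose
-- vertices are distinct because their distances to the path are; exits that are too long are
-- handled by induction on the distance.

-- Linear arithmetic by certificates: l ≤ r (or l ≡ r) is a sum of hypotheses, c is the slack, and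
-- the remaining identity between linear expressions is left to the ring solver.
lin : ∀ {l r m n} → l ≤ r → ∀ c → m + r + c ≡ n + l → m ≤ n
lin {l} {r} {m} {n} l≤r c eq = +-cancelʳ-≤ l m n
  (≤-trans (+-monoʳ-≤ m l≤r) (≤-trans (m≤m+n (m + r) c) (≤-reflexive eq)))

lin-⊥ : ∀ {A : Set} {l r} → l ≤ r → ∀ c → 1 + r + c ≡ 0 + l → A
lin-⊥ l≤r c eq = ⊥-elim (n≮0 (lin {m = 1} {n = 0} l≤r c eq))

lin-≡ : ∀ {l r m n} → l ≡ r → m + r ≡ n + l → m ≡ n
lin-≡ {l} {m = m} {n} refl eq = +-cancelʳ-≡ l m n eq

infixr 6 _⊹_ _⊞_
_⊹_ : ∀ {a b c d} → a ≤ b → c ≤ d → a + c ≤ b + d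
_⊹_ = +-mono-≤

_⊞_ : ∀ {a b c d} → a ≡ b → c ≡ d → a + c ≡ b + d
_⊞_ = cong₂ _+_

private
  variable
    ℓ m n : ℕ

-- Reversed digraphs, trails and their concatenation

opposite : {V : Set} → Digraph V → Digraph V
opposite D = record
  { Arc      = λ a b → Arc D b a
  ; arc?     = λ a b → arc? D b a
  ; loopless = loopless D
  }

-- Unlike in Path, the vertices are confined to a set, so that concatenations can be checked for
-- repetitions by comparing these sets.
record Trail {V : Set} (D : Digraph V) (S : V → Set) (a b : V) (ℓ : ℕ) : Set where
  constructor trail
  field
    walk   : Walk D a b ℓ
    unique : Unique (vertices D walk)
    inside : All S (vertices D walk)

module _ {V : Set} {D : Digraph V} where

  private
    variable
      S T : V → Set
      a b c d : V

  join-walk : Walk D a b m → Arc D b c → Walk D c d n → Walk D a d (m + suc n)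
  join-walk [ _ ]   e w′ = e ∷ w′
  join-walk (f ∷ w) e w′ = f ∷ join-walk w e w′

  vertices-join : (w : Walk D a b m) (e : Arc D b c) (w′ : Walk D c d n) →
                  vertices D (join-walk w e w′) ≡ vertices D w ++ vertices D w′
  vertices-join [ _ ]   e w′ = refl
  vertices-join (f ∷ w) e w′ = cong (_ ∷_) (vertices-join w e w′)

  point : S a → Trail D S a a 0
  point s = trail [ _ ] ([] ∷ []) (s ∷ [])

  widen : (∀ {v} → S v → T v) → Trail D S a b ℓ → Trail D T a b ℓ
  widen S⊆T (trail w u s) = trail w u (All.map S⊆T s)

  join : Trail D S a b m → Arc D b c → Trail D T c d n → (∀ {v} → S v → ¬ T v) →
         Trail D (λ v → S v ⊎ T v) a d (m + suc n)
  join (trail w u s) e (trail w′ u′ t) disjoint = trail (join-walk w e w′)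
    (subst Unique (sym (vertices-join w e w′))
      (++⁺ u u′ (All.map (λ sv → All.map (λ { tv refl → disjoint sv tv }) t) s)))
    (subst (All _) (sym (vertices-join w e w′))
      (All.++⁺ (All.map inj₁ s) (All.map inj₂ t)))

module _ {V : Set} {D : Digraph V} where

  reverse-walk : ∀ {a b} → Walk D a b ℓ → Walk (opposite D) b a ℓ
  reverse-walk [ _ ] = [ _ ]
  reverse-walk {suc ℓ} (e ∷ w) =
    subst (Walk (opposite D) _ _) (+-comm ℓ 1) (join-walk (reverse-walk w) e [ _ ])

  reverse-trail : ∀ {S : V → Set} {a b} → Trail D S a b ℓ → Trail (opposite D) S b a ℓ
  reverse-trail (trail [ _ ] u s) = trail [ _ ] u s
  reverse-trail {suc ℓ} {S} {a} (trail (e ∷ w) (a∉ ∷ u) (sa ∷ s)) =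
    subst (Trail (opposite D) S _ a) (+-comm ℓ 1) (widen merge
      (join (reverse-trail (trail w u (All.zip (s , a∉)))) e (point {S = _≡ a} refl)
        λ { (_ , a≢v) refl → a≢v refl }))
    where
    merge : ∀ {v} → (S v × a ≢ v) ⊎ v ≡ a → S v
    merge (inj₁ (sv , _)) = sv
    merge (inj₂ refl)     = sa

module _ {n} {D : Digraph (Fin n)} where

  private
    ∉⇒All≢ : ∀ {a} (vs : Vec (Fin n) m) → ¬ a ∈ᵛ vs → All (a ≢_) vs
    ∉⇒All≢ []       _    = []
    ∉⇒All≢ (v ∷ vs) a∉vs = (λ a≡v → a∉vs (here a≡v)) ∷ ∉⇒All≢ vs (λ a∈vs → a∉vs (there a∈vs))

    suffix : ∀ {a b c} (w : Walk D b c ℓ) → Unique (vertices D w) → a ∈ᵛ vertices D w →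
             ∃[ m ] m ≤ ℓ × Path D a c m
    suffix [ _ ]   u       (here refl) = _ , ≤-refl , path [ _ ] u
    suffix (e ∷ w) u       (here refl) = _ , ≤-refl , path (e ∷ w) u
    suffix (_ ∷ w) (_ ∷ u) (there a∈w) with suffix w u a∈w
    ... | m , m≤ℓ , p = m , m≤n⇒m≤1+n m≤ℓ , p

  walk⇒path : ∀ {a b} → Walk D a b ℓ → ∃[ m ] m ≤ ℓ × Path D a b m
  walk⇒path [ _ ] = _ , z≤n , path [ _ ] ([] ∷ [])
  walk⇒path {a = a} (e ∷ w) with walk⇒path w
  ... | m , m≤ℓ , path w′ u with _∈?_ Fin._≟_ a (vertices D w′)
  ...   | yes a∈w′ with suffix w′ u a∈w′
  ...     | m′ , m′≤m , p = m′ , m≤n⇒m≤1+n (≤-trans m′≤m m≤ℓ) , p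
  walk⇒path {a = a} (e ∷ w) | m , m≤ℓ , path w′ u | no a∉w′ =
    suc m , s≤s m≤ℓ , path (e ∷ w′) (∉⇒All≢ _ a∉w′ ∷ u)

-- Geodesics and their backward chords

-- The form of a shortest path that survives reversal of all arcs. Values of `vertex` beyond `2 + k`
-- are arbitrary. `short` is stated for walks, so that it applies to any concatenation without a
-- check for repetitions.
record Geodesic {n} (D : Digraph (Fin n)) (k : ℕ) : Set where
  field
    vertex : ℕ → Fin n
    step   : ∀ i → i < 2 + k → Arc D (vertex i) (vertex (suc i))
    short  : ∀ i j {ℓ} → i ≤ 2 + k → j ≤ 2 + k → Walk D (vertex i) (vertex j) ℓ → j ≤ i + ℓ
    quasi  : QuasiTransitive D k

≤⇒∃ : m ≤ n → ∃[ d ] m + d ≡ n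
≤⇒∃ m≤n = _ , m+[n∸m]≡n m≤n

module Backbone {n k} (h : ℕ) (k≡ : k ≡ 5 + (h + h)) {D : Digraph (Fin n)} (G : Geodesic D k) where

  open Geodesic G public renaming (vertex to x)

  private
    variable
      B C i j t : ℕ
      a b c z w : Fin n
      S : Fin n → Set

  quasi-trail : Trail D S a b ℓ → ℓ ≡ k → Adjacent D a b
  quasi-trail (trail w u _) refl = quasi (path w u)

  x-injective : i ≤ 2 + k → j ≤ 2 + k → x i ≡ x j → i ≡ j
  x-injective {i} {j} i≤ j≤ eq = ≤-antisym
    (lin p 0 (solve (i ∷ˡ j ∷ˡ []ˡ)))
    (lin q 0 (solve (i ∷ˡ j ∷ˡ []ˡ)))
    where
    p : i ≤ j + 0
    p = short j i j≤ i≤ (subst (λ v → Walk D v (x i) 0) eq [ _ ])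
    q : j ≤ i + 0
    q = short i j i≤ j≤ (subst (λ v → Walk D (x i) v 0) eq [ _ ])

  Below : ℕ → Fin n → Set
  Below B v = ∃[ m ] m < B × v ≡ x m

  Segment : ℕ → ℕ → Fin n → Set
  Segment i t v = ∃[ m ] i ≤ m × m ≤ t × v ≡ x m

  Out : Fin n → Set
  Out v = ¬ Below (3 + k) v

  segment⇒below : ∀ {v} → Segment i t v → Below (suc t) v
  segment⇒below (m , _ , m≤t , eq) = m , s≤s m≤t , eq

  segment∩below : ∀ {v} → t ≤ 2 + k → B ≤ i → Segment i t v → ¬ Below B v
  segment∩below {t} {B} {i} t≤ B≤i (m , i≤m , m≤t , eq) (m′ , m′<B , eq′) =
    (lin-⊥ (≤-reflexive m≡m′ ⊹ i≤m ⊹ m′<B ⊹ B≤i) 0 (solve (B ∷ˡ i ∷ˡ m ∷ˡ m′ ∷ˡ []ˡ)))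
    where
    m′≤ : m′ ≤ 2 + k
    m′≤ = lin (t≤ ⊹ m≤t ⊹ i≤m ⊹ m′<B ⊹ B≤i) 1 (solve (B ∷ˡ i ∷ˡ k ∷ˡ m ∷ˡ m′ ∷ˡ t ∷ˡ []ˡ))
    m≡m′ : m ≡ m′
    m≡m′ = x-injective (≤-trans m≤t t≤) m′≤ (trans (sym eq) eq′)

  lower : B ≤ C → Trail D (Below B) a b ℓ → Trail D (Below C) a b ℓ
  lower B≤C = widen λ { (m , m<B , eq) → m , ≤-trans m<B B≤C , eq }

  segment : ∀ i d t → i + d ≡ t → t ≤ 2 + k → Trail D (Segment i t) (x i) (x t) d
  segment i zero t e t≤ = subst (λ t → Trail D (Segment i t) (x i) (x t) 0)
    (trans (sym (+-identityʳ i)) e) (point (i , ≤-refl , ≤-refl , refl))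
  segment i (suc d) t e t≤ = widen merge
    (join (point {S = _≡ x i} refl) (step i i<) (segment (suc i) d t (lin-≡ e
        (solve (d ∷ˡ i ∷ˡ t ∷ˡ []ˡ))) t≤)
      λ { refl (m , i<m , m≤t , eq) → 1+n≰n (subst (suc i ≤_) (sym (x-injective (<⇒≤ i<) (≤-trans m≤t t≤) eq)) i<m) })
    where
    i≤t : i ≤ t
    i≤t = lin (≤-reflexive e) (1 + d) (solve (d ∷ˡ i ∷ˡ t ∷ˡ []ˡ))
    i< : i < 2 + k
    i< = lin (≤-reflexive e ⊹ t≤) d (solve (d ∷ˡ i ∷ˡ k ∷ˡ t ∷ˡ []ˡ))
    merge : ∀ {v} → v ≡ x i ⊎ Segment (suc i) t v → Segment i t v
    merge (inj₁ eq)                = i , ≤-refl , i≤t , eq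
    merge (inj₂ (m , i<m , m≤t , eq)) = m , <⇒≤ i<m , m≤t , eq

  run : ∀ i d t → i + d ≡ t → t ≤ 2 + k → Trail D (Below (suc t)) (x i) (x t) d
  run i d t e t≤ = widen segment⇒below (segment i d t e t≤)

  -- The continuation stays below `B ≤ i`, so it cannot meet the segment. Long paths are therefore
  -- assembled from segments that are traversed in order of decreasing index.
  jump : ∀ i d t → i + d ≡ t → t ≤ 2 + k → Arc D (x t) c → Trail D (Below B) c b ℓ → B ≤ i →
         Trail D (Below (suc t)) (x i) b (d + suc ℓ)
  jump {B = B} i d t e t≤ f r B≤i =
    widen merge (join (segment i d t e t≤) f r (segment∩below t≤ B≤i))
    where
    merge : ∀ {v} → Segment i t v ⊎ Below B v → Below (suc t) v
    merge (inj₁ s)              = segment⇒below s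
    merge (inj₂ (m , m<B , eq)) =
      m , (lin (m<B ⊹ B≤i ⊹ ≤-reflexive e) (1 + d) (solve (B ∷ˡ d ∷ˡ i ∷ˡ m ∷ˡ t ∷ˡ []ˡ))) , eq

  stay : ∀ i → i ≤ 2 + k → Trail D (Below (suc i)) (x i) (x i) 0
  stay i = run i 0 i (+-identityʳ i)

  backward : ∀ i j → suc i < j → j ≤ 2 + k → Adjacent D (x j) (x i) → Arc D (x j) (x i)
  backward i j i+1<j j≤ (inj₁ f) = f
  backward i j i+1<j j≤ (inj₂ f) = lin-⊥ (p ⊹ i+1<j) 0 (solve (i ∷ˡ j ∷ˡ []ˡ))
    where
    p : j ≤ i + 1
    p = short i j (lin (i+1<j ⊹ j≤) 2 (solve (i ∷ˡ j ∷ˡ k ∷ˡ []ˡ))) j≤ (f ∷ [ _ ])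

  back-k : ∀ i t → i + k ≡ t → t ≤ 2 + k → Arc D (x t) (x i)
  back-k i t e t≤ = backward i t (lin (≤-reflexive e ⊹ ≤-reflexive (sym k≡)) (3 + h + h)
      (solve (h ∷ˡ i ∷ˡ k ∷ˡ t ∷ˡ []ˡ))) t≤
    (swap (quasi-trail (run i k t e t≤) refl))

  -- The path x_N, x_2, ..., x_k, x_0 has 1 + (k - 2) + 1 arcs and uses two chords of length k.
  back-all : Arc D (x (2 + k)) (x 0)
  back-all = backward 0 (2 + k) (lin (z≤n {0}) k (solve (k ∷ˡ []ˡ))) ≤-refl (quasi-trail
    (jump (2 + k) 0 (2 + k) (+-identityʳ (2 + k)) ≤-refl (back-k 2 (2 + k) refl ≤-refl)
      (jump 2 (3 + (h + h)) k (lin-≡ (sym k≡)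
          (solve (h ∷ˡ k ∷ˡ []ˡ))) (m≤n+m k 2) (back-k 0 k refl (m≤n+m k 2))
        (stay 0 z≤n) (s≤s z≤n))
      (n≤1+n _))
    (lin-≡ (sym k≡) (solve (h ∷ˡ k ∷ˡ []ˡ))))

  -- The path x_{i+3} ... x_N, x_0 ... x_i omits three of the k + 3 arcs of the cycle closed by
  -- `back-all`.
  back-3 : ∀ i → 3 + i ≤ 2 + k → Arc D (x (3 + i)) (x i)
  back-3 i i≤ with ≤⇒∃ i≤
  ... | d , e = backward i (3 + i) (n≤1+n _) i≤ (quasi-trail
    (jump (3 + i) d (2 + k) e ≤-refl back-all
      (run 0 i i refl (lin i≤ 3 (solve (i ∷ˡ k ∷ˡ []ˡ)))) (lin (z≤n {0}) 2 (solve (i ∷ˡ []ˡ))))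
    (lin-≡ e (solve (d ∷ˡ i ∷ˡ k ∷ˡ []ˡ))))

  -- Induction over odd t: for t ≤ k + 1 the path x_t ... x_{k+1}, x_1 ... x_{t-2}, x_0 has k arcs
  -- and ends with the previous chord.
  back-to-0 : ∀ g t → 3 + (g + g) ≡ t → t ≤ 2 + k → Arc D (x t) (x 0)
  back-to-0 zero t refl t≤ = back-3 0 t≤
  back-to-0 (suc g) t e t≤ with t ≤? 1 + k
  ... | no t≰ with ≤-antisym t≤ (≰⇒> t≰)
  ...   | refl = back-all
  back-to-0 (suc g) t e t≤ | yes t≤′ with ≤⇒∃ t≤′
  ... | d , e′ = backward 0 t (lin (≤-reflexive e) (3 + g + g) (solve (g ∷ˡ t ∷ˡ []ˡ))) t≤ (quasi-trail
    (jump t d (1 + k) e′ (n≤1+n _) (back-k 1 (1 + k) refl (n≤1+n _))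
      (jump 1 (2 + (g + g)) (3 + (g + g)) refl s≤ (back-to-0 g (3 + (g + g)) refl s≤) (stay 0 z≤n) (s≤s z≤n))
      (lin (≤-reflexive e) 1 (solve (g ∷ˡ t ∷ˡ []ˡ))))
    (lin-≡ (e ⊞ e′) (solve (d ∷ˡ g ∷ˡ k ∷ˡ t ∷ˡ []ˡ))))
    where
    s≤ : 3 + (g + g) ≤ 2 + k
    s≤ = lin (≤-reflexive e ⊹ t≤) 2 (solve (g ∷ˡ k ∷ˡ t ∷ˡ []ˡ))

-- Reversal

module _ {n k} {D : Digraph (Fin n)} (G : Geodesic D k) where

  open Geodesic G renaming (vertex to x)

  private
    y : ℕ → Fin n
    y i = x (2 + k ∸ i)

  mirror : ∀ i j → i + j ≡ 2 + k → y i ≡ x j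
  mirror i j e = cong x (trans (cong (_∸ i) (sym e)) (m+n∸m≡n i j))

  opposite-geodesic : Geodesic (opposite D) k
  opposite-geodesic = record
    { vertex = y
    ; step   = λ i i< → op-step i (≤⇒∃ i<)
    ; short  = λ i j i≤ j≤ w → op-short i j (≤⇒∃ i≤) (≤⇒∃ j≤) w
    ; quasi  = λ { (path w u) → op-quasi (reverse-trail (trail {S = λ v → v ≡ v} w u (All.universal (λ _ → refl) _))) }
    }
    where
    op-step : ∀ i → ∃[ d ] suc i + d ≡ 2 + k → Arc D (y (suc i)) (y i)
    op-step i (d , e) = subst₂ (Arc D)
      (sym (mirror _ _ e)) (sym (mirror _ _ (trans (+-suc i d) e)))
      (step d (lin (≤-reflexive e) i (solve (d ∷ˡ i ∷ˡ k ∷ˡ []ˡ))))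
    op-short : ∀ i j {ℓ} → ∃[ d ] i + d ≡ 2 + k → ∃[ d ] j + d ≡ 2 + k →
               Walk (opposite D) (y i) (y j) ℓ → j ≤ i + ℓ
    op-short i j {ℓ} (i′ , e) (j′ , e′) w =
      (lin (≤-reflexive (sym e) ⊹ ≤-reflexive e′ ⊹ p) 0 (solve (i ∷ˡ i′ ∷ˡ j ∷ˡ j′ ∷ˡ k ∷ˡ ℓ ∷ˡ []ˡ)))
      where
      p : i′ ≤ j′ + ℓ
      p = short j′ i′ (lin (≤-reflexive e′) j
          (solve (j ∷ˡ j′ ∷ˡ k ∷ˡ []ˡ))) (lin (≤-reflexive e) i (solve (i ∷ˡ i′ ∷ˡ k ∷ˡ []ˡ)))
            (subst₂ (λ a b → Walk D a b ℓ) (mirror _ _ e′) (mirror _ _ e) (reverse-walk w))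
    op-quasi : ∀ {a b S} → Trail D S b a k → Adjacent D b a
    op-quasi (trail w u _) = quasi (path w u)

parity : ∀ j → ∃[ p ] ∃[ q ] p ≤ 1 × p + (q + q) ≡ j
parity zero    = 0 , 0 , z≤n , refl
parity (suc j) with parity j
... | zero        , q , _       , refl = 1 , q , ≤-refl , refl
... | suc zero    , q , _       , refl = 0 , suc q , z≤n , cong suc (+-suc q q)
... | suc (suc p) , q , s≤s ()  , _

-- Vertices off the path

module Rays {n k} (h : ℕ) (k≡ : k ≡ 5 + (h + h)) {D : Digraph (Fin n)} (G : Geodesic D k) where

  open Backbone h k≡ G public

  private
    module Op = Backbone h k≡ (opposite-geodesic G)
    variable
      B i j g : ℕ
      z y b : Fin n
      S : Fin n → Set

  -- As N is odd, reversal turns the chords from odd indices to x_0 into chords from x_N to even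
  -- indices.
  N-to-even : ∀ s g → s + (3 + (g + g)) ≡ 2 + k → Arc D (x (2 + k)) (x s)
  N-to-even s g e = subst (λ v → Arc D (x (2 + k)) v)
    (mirror G (3 + (g + g)) s (lin-≡ e (solve (g ∷ˡ k ∷ˡ s ∷ˡ []ˡ))))
    (Op.back-to-0 g (3 + (g + g)) refl (lin (≤-reflexive e) s (solve (g ∷ˡ k ∷ˡ s ∷ˡ []ˡ))))

  exit : ∀ {m} → Trail D S z y m → (∀ {v} → S v → Out v) → Arc D y (x i) →
         Trail D (Below B) (x i) b ℓ → B ≤ 3 + k → m + suc ℓ ≡ k → Adjacent D z b
  exit r out f r′ B≤ e = quasi-trail
    (join r f r′ λ { sv (m , m<B , eq) → out sv (m , ≤-trans m<B B≤ , eq) }) e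

  leave : Out z → Arc D z (x i) → Trail D (Below B) (x i) b ℓ → B ≤ 3 + k → suc ℓ ≡ k → Adjacent D z b
  leave {z} out = exit (point {S = _≡ z} refl) (λ { refl → out })

  cyc : ∀ i j → Out z → Arc D z (x i) → i + (4 + (h + h)) ≡ j → i ≤ 3 → Adjacent D z (x j)
  cyc i j out f e i≤3 = leave out f (run i (4 + (h + h)) j e j≤) (s≤s j≤) (sym k≡)
    where
    j≤ : j ≤ 2 + k
    j≤ = lin (≤-reflexive (sym e) ⊹ i≤3 ⊹ ≤-reflexive (sym k≡)) 0 (solve (h ∷ˡ i ∷ˡ j ∷ˡ k ∷ˡ []ˡ))

  -- The path x_i … x_N, x_s … x_t, x_0 … x_j with s even and t odd, where x_s is the first even
  -- vertex above x_j.
  down-far : ∀ g j i → Out z → Arc D z (x i) → j + (6 + (g + g)) ≡ i → i ≤ 2 + k → Adjacent D z (x j)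
  down-far g j i out f e i≤ with ≤⇒∃ i≤ | parity j
  ... | d , e′ | p , q , p≤1 , pq = leave out f
    (jump i d (2 + k) e′ ≤-refl (N-to-even s (proj₁ g′) (s+g′≡ g′))
      (jump s (1 + (g + g)) t (2 + (q + q) + (1 + (g + g)) ≡ 3 + ((q + g) + (q + g)) ∋ solve (g ∷ˡ q ∷ˡ []ˡ)) t≤
        (back-to-0 (q + g) t refl t≤)
        (run 0 j j refl (lin (≤-reflexive e ⊹ i≤) (6 + g + g) (solve (g ∷ˡ i ∷ˡ j ∷ˡ k ∷ˡ []ˡ))))
        (suc j ≤ 2 + (q + q) ∋ lin (≤-reflexive (sym pq) ⊹ p≤1) 0 (solve (j ∷ˡ p ∷ˡ q ∷ˡ []ˡ))))
      (4 + ((q + g) + (q + g)) ≤ i ∋ lin (≤-reflexive e ⊹ ≤-reflexive pq) (2 + p)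
          (solve (g ∷ˡ i ∷ˡ j ∷ˡ p ∷ˡ q ∷ˡ []ˡ))))
    ≤-refl
    (lin-≡ (e ⊞ e′) (solve (d ∷ˡ g ∷ˡ i ∷ˡ j ∷ˡ k ∷ˡ []ˡ)))
    where
    s t : ℕ
    s = 2 + (q + q)
    t = 3 + ((q + g) + (q + g))
    t≤ : t ≤ 2 + k
    t≤ = (3 + ((q + g) + (q + g)) ≤ 2 + k ∋ lin (≤-reflexive e ⊹ i≤ ⊹ ≤-reflexive pq) (3 + p)
        (solve (g ∷ˡ i ∷ˡ j ∷ˡ k ∷ˡ p ∷ˡ q ∷ˡ []ˡ)))
    q≤ : q ≤ 1 + h
    q≤ = ≮⇒≥ {1 + h} {q} λ h<q → (lin-⊥ (h<q ⊹ h<q ⊹ ≤-reflexive pq ⊹ ≤-reflexive e ⊹ i≤ ⊹ ≤-reflexive k≡) (2 + p + g + g)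
        (solve (g ∷ˡ h ∷ˡ i ∷ˡ j ∷ˡ k ∷ˡ p ∷ˡ q ∷ˡ []ˡ)))
    g′ : ∃[ g′ ] q + g′ ≡ 1 + h
    g′ = ≤⇒∃ q≤
    s+g′≡ : ∀ (g′ : ∃[ g′ ] q + g′ ≡ 1 + h) → s + (3 + (proj₁ g′ + proj₁ g′)) ≡ 2 + k
    s+g′≡ (g″ , e″) = (2 + (q + q) + (3 + (g″ + g″)) ≡ 2 + k ∋ lin-≡ (e″ ⊞ e″ ⊞ sym k≡)
        (solve (g″ ∷ˡ h ∷ˡ k ∷ˡ q ∷ˡ []ˡ)))

  -- Plain movement round the cycle by k - 1 arcs leads from i to i - 4, the case `suc zero`. A
  -- chord of length k that skips two vertices, x_k → x_0 or x_N → x_2, leads to i - 2 instead;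
  -- larger gaps need `down-far`.
  down : ∀ g j i → Out z → Arc D z (x i) → j + (2 + (g + g)) ≡ i → i ≤ 2 + k → Adjacent D z (x j)
  down zero j i out f e i≤ with i ≤? k
  ... | yes i≤k with ≤⇒∃ i≤k
  ...   | d , e′ = leave out f
    (jump i d k e′ (m≤n+m k 2) (back-k 0 k refl (m≤n+m k 2))
      (run 0 j j refl (lin (≤-reflexive e ⊹ i≤) 2 (solve (i ∷ˡ j ∷ˡ k ∷ˡ []ˡ))))
      (lin (≤-reflexive e) 1 (solve (i ∷ˡ j ∷ˡ []ˡ))))
    (lin (z≤n {0}) 2 (solve (k ∷ˡ []ˡ)))
    (lin-≡ (e ⊞ e′) (solve (d ∷ˡ i ∷ˡ j ∷ˡ k ∷ˡ []ˡ)))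
  down zero j i out f e i≤ | no i≰k
    with ≤⇒∃ i≤ | ≤⇒∃ (2 ≤ j ∋ lin ((≰⇒> i≰k) ⊹ ≤-reflexive (sym e) ⊹ ≤-reflexive (sym k≡)) (2 + h + h)
        (solve (h ∷ˡ i ∷ˡ j ∷ˡ k ∷ˡ []ˡ)))
  ... | d , e′ | d′ , e″ = leave out f
    (jump i d (2 + k) e′ ≤-refl (back-k 2 (2 + k) refl ≤-refl)
      (run 2 d′ j e″ (lin (≤-reflexive e ⊹ i≤) 2 (solve (i ∷ˡ j ∷ˡ k ∷ˡ []ˡ))))
      (lin (≤-reflexive e) 1 (solve (i ∷ˡ j ∷ˡ []ˡ))))
    ≤-refl
    (lin-≡ (e ⊞ e′ ⊞ e″) (solve (d ∷ˡ d′ ∷ˡ i ∷ˡ j ∷ˡ k ∷ˡ []ˡ)))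
  down (suc zero) j i out f e i≤ with ≤⇒∃ i≤
  ... | d , e′ = leave out f
    (jump i d (2 + k) e′ ≤-refl back-all
      (run 0 j j refl (lin (≤-reflexive e ⊹ i≤) 4 (solve (i ∷ˡ j ∷ˡ k ∷ˡ []ˡ))))
      (lin (≤-reflexive e) 3 (solve (i ∷ˡ j ∷ˡ []ˡ))))
    ≤-refl
    (lin-≡ (e ⊞ e′) (solve (d ∷ˡ i ∷ˡ j ∷ˡ k ∷ˡ []ˡ)))
  down (suc (suc g)) j i out f e i≤ =
    down-far g j i out f (lin-≡ e (solve (g ∷ˡ i ∷ˡ j ∷ˡ []ˡ))) i≤

  exit-to : ∀ {m w j} → Trail D S z y m → (∀ {v} → S v → Out v) → ¬ S w → Out w → Arc D y (x i) →
            Trail D (Below B) (x i) (x j) ℓ → B ≤ 3 + k → Arc D (x j) w → (m + suc ℓ) + 1 ≡ k → Adjacent D z w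
  exit-to {w = w} r out w∉S w-out f r′ B≤ f′ e = quasi-trail
    (join (join r f r′ λ { sv (m , m<B , eq) → out sv (m , ≤-trans m<B B≤ , eq) }) f′
      (point {S = _≡ w} refl)
      λ { (inj₁ sv) refl → w∉S sv ; (inj₂ (m , m<B , eq)) refl → w-out (m , ≤-trans m<B B≤ , eq) }) e

  -- The path z, x_i ... x_{i+k-2}, w has k arcs.
  link : ∀ {w} i j → Out z → Out w → z ≢ w → i + (3 + (h + h)) ≡ j → j ≤ 2 + k →
         Arc D z (x i) → Arc D (x j) w → Adjacent D z w
  link {z} i j z-out w-out z≢w e j≤ f f′ =
    exit-to (point {S = _≡ z} refl) (λ { refl → z-out }) (λ w≡z → z≢w (sym w≡z)) w-out f
      (run i (3 + (h + h)) j e j≤) (s≤s j≤) f′ (lin-≡ (sym k≡) (solve (h ∷ˡ k ∷ˡ []ˡ)))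

  via : ∀ a b → a ≤ 2 + k → b ≤ 2 + k → Arc D (x a) z → Arc D z (x b) → b ≤ a + 2
  via a b a≤ b≤ f f′ = short a b a≤ b≤ (f ∷ (f′ ∷ [ _ ]))

-- Extreme path indices of each parity

module Corners {n k} (h : ℕ) (k≡ : k ≡ 5 + (h + h)) {D : Digraph (Fin n)} (G : Geodesic D k) where

  open Rays h k≡ G public

  private
    module Op = Rays h k≡ (opposite-geodesic G)
    variable
      z w : Fin n

  Touches : Fin n → ℕ → Set
  Touches z j = Adjacent D z (x j)

  -- An index of parity p is written `p + (q + q)`, and a pair of different parities is given by
  -- `p + p′ ≡ 1`, so that one proof serves both orders.
  HasParity : ℕ → Fin n → Set
  HasParity p z = ∃[ q ] p + (q + q) ≤ 2 + k × Touches z (p + (q + q))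

  NoArcTo NoArcFrom : ℕ → Fin n → Set
  NoArcTo   p z = ∀ q j → p + (q + q) ≡ j → j ≤ 2 + k → ¬ Arc D z (x j)
  NoArcFrom p z = ∀ q j → p + (q + q) ≡ j → j ≤ 2 + k → ¬ Arc D (x j) z

  has-parity : ∀ p q j → p + (q + q) ≡ j → j ≤ 2 + k → Touches z j → HasParity p z
  has-parity p q j refl j≤ t = q , j≤ , t

  out-op : Out z → Op.Out z
  out-op out (m , m< , eq) = out (_ , s≤s (m∸n≤m (2 + k) m) , eq)

  arc-to-op : ∀ i j → i + j ≡ 2 + k → Arc D z (x j) → Arc D z (Op.x i)
  arc-to-op i j e = subst (Arc D _) (sym (mirror G i j e))

  arc-from-op : ∀ i j → i + j ≡ 2 + k → Arc D (x j) z → Arc D (Op.x i) z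
  arc-from-op i j e = subst (λ v → Arc D v _) (sym (mirror G i j e))

  touches-op : ∀ i j → i + j ≡ 2 + k → Adjacent (opposite D) z (Op.x i) → Touches z j
  touches-op i j e t = swap (subst (Adjacent (opposite D) _) (mirror G i j e) t)

  up : ∀ g i j → Out z → Arc D (x i) z → i + (2 + (g + g)) ≡ j → j ≤ 2 + k → Touches z j
  up g i j out f e j≤ with ≤⇒∃ j≤
  ... | j′ , e′ = touches-op j′ j (lin-≡ e′ (solve (j ∷ˡ j′ ∷ˡ k ∷ˡ []ˡ)))
    (Op.down g j′ (i′ j′) (out-op out)
      (arc-from-op (i′ j′) i (j′ + (2 + (g + g)) + i ≡ 2 + k ∋ lin-≡ (e′ ⊞ e)
          (solve (g ∷ˡ i ∷ˡ j ∷ˡ j′ ∷ˡ k ∷ˡ []ˡ))) f)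
      refl (j′ + (2 + (g + g)) ≤ 2 + k ∋ lin (≤-reflexive e′ ⊹ ≤-reflexive e) i
          (solve (g ∷ˡ i ∷ˡ j ∷ˡ j′ ∷ˡ k ∷ˡ []ˡ))))
    where
    i′ : ℕ → ℕ
    i′ j′ = j′ + (2 + (g + g))

  cyc-op : ∀ i j → Out z → Arc D (x j) z → i + (4 + (h + h)) ≡ j → j ≤ 2 + k → Touches z i
  cyc-op i j out f e j≤ with ≤⇒∃ j≤
  ... | j′ , e′ = touches-op (j′ + (4 + (h + h))) i
    (lin-≡ (e′ ⊞ e) (solve (h ∷ˡ i ∷ˡ j ∷ˡ j′ ∷ˡ k ∷ˡ []ˡ)))
    (Op.cyc j′ (j′ + (4 + (h + h))) (out-op out)
      (arc-from-op j′ j (lin-≡ e′ (solve (j ∷ˡ j′ ∷ˡ k ∷ˡ []ˡ))) f) refl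
      (lin (≤-reflexive e′ ⊹ ≤-reflexive e ⊹ ≤-reflexive k≡) i (solve (h ∷ˡ i ∷ˡ j ∷ˡ j′ ∷ˡ k ∷ˡ []ˡ))))

  down≤ : ∀ p a b → Out z → p + (b + b) ≤ 2 + k → a ≤ b → Arc D z (x (p + (b + b))) → Touches z (p + (a + a))
  down≤ p a b out b≤ a≤b f with ≤⇒∃ a≤b
  ... | zero  , e = inj₁ (subst (λ b → Arc D _ (x (p + (b + b)))) (trans (sym e) (+-identityʳ a)) f)
  ... | suc g , e = down g (p + (a + a)) (p + (b + b)) out f
                      (lin-≡ (e ⊞ e) (solve (a ∷ˡ b ∷ˡ g ∷ˡ p ∷ˡ []ˡ))) b≤

  up≤ : ∀ p a b → Out z → p + (b + b) ≤ 2 + k → a ≤ b → Arc D (x (p + (a + a))) z → Touches z (p + (b + b))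
  up≤ p a b out b≤ a≤b f with ≤⇒∃ a≤b
  ... | zero  , e = inj₂ (subst (λ b → Arc D (x (p + (b + b))) _) (trans (sym (+-identityʳ a)) e) f)
  ... | suc g , e = up g (p + (a + a)) (p + (b + b)) out f
                      (lin-≡ (e ⊞ e) (solve (a ∷ˡ b ∷ˡ g ∷ˡ p ∷ˡ []ˡ))) b≤

  -- The two lowest and two highest indices of parity p, namely p, p + 2, p + k - 1 and p + k + 1.
  -- Reversal exchanges the sets of the two parities.
  CornerSet : ℕ → Fin n → Set
  CornerSet p z = Touches z (p + (0 + 0)) × Touches z (p + (1 + 1)) ×
                  Touches z (p + ((2 + h) + (2 + h))) × Touches z (p + ((3 + h) + (3 + h)))

  module _ (p : ℕ) (p≤1 : p ≤ 1) {z : Fin n} (out : Out z) where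

    private
      ≤₁ : p + (1 + 1) ≤ 2 + k
      ≤₁ = lin (p≤1 ⊹ ≤-reflexive (sym k≡)) (4 + h + h) (solve (h ∷ˡ k ∷ˡ p ∷ˡ []ˡ))
      ≤₂ : p + ((2 + h) + (2 + h)) ≤ 2 + k
      ≤₂ = lin (p≤1 ⊹ ≤-reflexive (sym k≡)) 2 (solve (h ∷ˡ k ∷ˡ p ∷ˡ []ˡ))
      ≤₃ : p + ((3 + h) + (3 + h)) ≤ 2 + k
      ≤₃ = lin (p≤1 ⊹ ≤-reflexive (sym k≡)) 0 (solve (h ∷ˡ k ∷ˡ p ∷ˡ []ˡ))
      0⇒2 : p + 0 + (4 + (h + h)) ≡ p + ((2 + h) + (2 + h))
      0⇒2 = solve (h ∷ˡ p ∷ˡ []ˡ)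
      1⇒3 : p + 2 + (4 + (h + h)) ≡ p + ((3 + h) + (3 + h))
      1⇒3 = solve (h ∷ˡ p ∷ˡ []ˡ)
      p+2≤3 : p + 2 ≤ 3
      p+2≤3 = lin p≤1 0 (solve (p ∷ˡ []ˡ))
      p+0≤3 : p + 0 ≤ 3
      p+0≤3 = lin p≤1 2 (solve (p ∷ˡ []ˡ))

    -- Arcs from z spread adjacency downwards, arcs to z spread it upwards, and `cyc` and `cyc-op`
    -- pass between indices k - 1 apart. Whatever the direction at a corner, one of these leads on
    -- to the next.
    corners-from-arc : ∀ q → p + (q + q) ≤ 2 + k → Arc D z (x (p + (q + q))) → CornerSet p z
    corners-from-arc q q≤ f = case₀ (down≤ p 0 q out q≤ z≤n f)
      where
      t₃ : Touches z (p + (1 + 1)) → Touches z (p + ((3 + h) + (3 + h)))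
      t₃ (inj₁ f₁) = cyc (p + 2) (p + ((3 + h) + (3 + h))) out f₁ 1⇒3 p+2≤3
      t₃ (inj₂ g₁) = up≤ p 1 (3 + h) out ≤₃ (s≤s z≤n) g₁
      t₁ : Touches z (p + ((3 + h) + (3 + h))) → Touches z (p + (1 + 1))
      t₁ (inj₁ f₃) = down≤ p 1 (3 + h) out ≤₃ (s≤s z≤n) f₃
      t₁ (inj₂ g₃) = cyc-op (p + 2) (p + ((3 + h) + (3 + h))) out g₃ 1⇒3 ≤₃
      case₂ : Arc D z (x (p + 0)) → Touches z (p + ((2 + h) + (2 + h))) → CornerSet p z
      case₂ f₀ (inj₁ f₂) = inj₁ f₀ , t , inj₁ f₂ , t₃ t
        where
        t : Touches z (p + (1 + 1))
        t = down≤ p 1 (2 + h) out ≤₂ (s≤s z≤n) f₂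
      case₂ f₀ (inj₂ g₂) = inj₁ f₀ , t₁ t , inj₂ g₂ , t
        where
        t : Touches z (p + ((3 + h) + (3 + h)))
        t = up≤ p (2 + h) (3 + h) out ≤₃ (n≤1+n _) g₂
      case₀ : Touches z (p + (0 + 0)) → CornerSet p z
      case₀ (inj₁ f₀) = case₂ f₀ (cyc (p + 0) (p + ((2 + h) + (2 + h))) out f₀ 0⇒2 p+0≤3)
      case₀ (inj₂ g₀) = inj₂ g₀ , up≤ p 0 1 out ≤₁ z≤n g₀
        , up≤ p 0 (2 + h) out ≤₂ z≤n g₀ , up≤ p 0 (3 + h) out ≤₃ z≤n g₀

-- Nonadjacent vertices of opposite parities

module Pairs {n k} (h : ℕ) (k≡ : k ≡ 5 + (h + h)) {D : Digraph (Fin n)} (G : Geodesic D k) where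

  open Corners h k≡ G public

  private
    module Op = Corners h k≡ (opposite-geodesic G)
    variable
      z w : Fin n

  at : ∀ {i j} → i ≡ j → Touches z i → Touches z j
  at refl t = t

  arc-at : ∀ {i j} → i ≡ j → Arc D (x i) z → Arc D (x j) z
  arc-at refl f = f

  touches-to-op : ∀ i j → i + j ≡ 2 + k → Touches z j → Op.Touches z i
  touches-to-op i j e t = swap (subst (Adjacent D _) (sym (mirror G i j e)) t)

  opposite-half : ∀ p q → p + (q + q) ≤ 2 + k → ∃[ q′ ] q + q′ ≡ 3 + h
  opposite-half p q q≤ = ≤⇒∃ (≮⇒≥ {3 + h} {q} λ h<q →
    (lin-⊥ (h<q ⊹ h<q ⊹ q≤ ⊹ ≤-reflexive k≡) p (solve (h ∷ˡ k ∷ˡ p ∷ˡ q ∷ˡ []ˡ))))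

  opposite-index : ∀ p p′ q q′ → p + p′ ≡ 1 → q + q′ ≡ 3 + h → p′ + (q′ + q′) + (p + (q + q)) ≡ 2 + k
  opposite-index p p′ q q′ pp e =
    (lin-≡ (e ⊞ e ⊞ pp ⊞ sym k≡) (solve (h ∷ˡ k ∷ˡ p ∷ˡ p′ ∷ˡ q ∷ˡ q′ ∷ˡ []ˡ)))

  opposite-index≤ : ∀ p p′ q q′ → p + p′ ≡ 1 → q + q′ ≡ 3 + h → p′ + (q′ + q′) ≤ 2 + k
  opposite-index≤ p p′ q q′ pp e = subst (p′ + (q′ + q′) ≤_) (opposite-index p p′ q q′ pp e) (m≤m+n _ _)

  has-parity-op : ∀ p p′ → p + p′ ≡ 1 → HasParity p z → Op.HasParity p′ z
  has-parity-op p p′ pp (q , q≤ , t) with opposite-half p q q≤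
  ... | q′ , e = q′ , opposite-index≤ p p′ q q′ pp e
      , touches-to-op (p′ + (q′ + q′)) (p + (q + q)) (opposite-index p p′ q q′ pp e) t

  corners : ∀ p p′ → p + p′ ≡ 1 → Out z → HasParity p z → CornerSet p z
  corners p p′ pp out (q , q≤ , inj₁ f) = corners-from-arc p (subst (p ≤_) pp (m≤m+n p p′)) out q q≤ f
  corners {z} p p′ pp out (q , q≤ , inj₂ g) with opposite-half p q q≤
  ... | q′ , e = back (Op.corners-from-arc p′ (subst (p′ ≤_) pp (m≤n+m p′ p)) (out-op out) q′
                   (opposite-index≤ p p′ q q′ pp e)
                   (arc-from-op (p′ + (q′ + q′)) (p + (q + q)) (opposite-index p p′ q q′ pp e) g))
    where
    flip : ∀ a b → a + b ≡ 3 + h → Op.Touches z (p′ + (b + b)) → Touches z (p + (a + a))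
    flip a b e′ = touches-op (p′ + (b + b)) (p + (a + a)) (opposite-index p p′ a b pp e′)
    back : Op.CornerSet p′ z → CornerSet p z
    back (t₀ , t₁ , t₂ , t₃) =
      flip 0 (3 + h) refl t₃ , flip 1 (2 + h) refl t₂ ,
      flip (2 + h) 1 (+-comm (2 + h) 1) t₁ , flip (3 + h) 0 (+-identityʳ (3 + h)) t₀

  private
    1≤ : 1 ≤ 2 + k
    1≤ = s≤s z≤n
    2≤ : 2 ≤ 2 + k
    2≤ = s≤s (s≤s z≤n)
    3≤ : 3 ≤ 2 + k
    3≤ = lin (≤-reflexive (sym k≡)) (4 + h + h) (solve (h ∷ˡ k ∷ˡ []ˡ))
    3+2h≤ : 3 + (h + h) ≤ 2 + k
    3+2h≤ = lin (≤-reflexive (sym k≡)) 4 (solve (h ∷ˡ k ∷ˡ []ˡ))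
    4+2h≤ : 4 + (h + h) ≤ 2 + k
    4+2h≤ = lin (≤-reflexive (sym k≡)) 3 (solve (h ∷ˡ k ∷ˡ []ˡ))
    k≤ : k ≤ 2 + k
    k≤ = m≤n+m k 2
    1+k≤ : 1 + k ≤ 2 + k
    1+k≤ = n≤1+n _
    4+2h : (2 + h) + (2 + h) ≡ 4 + (h + h)
    4+2h = solve (h ∷ˡ []ˡ)
    6+2h : (3 + h) + (3 + h) ≡ 1 + k
    6+2h = lin-≡ (sym k≡) (solve (h ∷ˡ k ∷ˡ []ˡ))
    5+2h : 1 + ((2 + h) + (2 + h)) ≡ k
    5+2h = trans (cong suc 4+2h) (sym k≡)
    7+2h : 1 + ((3 + h) + (3 + h)) ≡ 2 + k
    7+2h = cong suc 6+2h
    3+2h : 1 + ((1 + h) + (1 + h)) ≡ 3 + (h + h)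
    3+2h = solve (h ∷ˡ []ˡ)
    2+3+2h : 2 + (3 + (h + h)) ≡ k
    2+3+2h = sym k≡
    3+3+2h : 3 + (3 + (h + h)) ≡ 1 + k
    3+3+2h = cong suc 2+3+2h

  corners-even : Out z → HasParity 0 z → Touches z 0 × Touches z 2 × Touches z (4 + (h + h)) × Touches z (1 + k)
  corners-even out r with corners 0 1 refl out r
  ... | t₀ , t₁ , t₂ , t₃ = t₀ , t₁ , at 4+2h t₂ , at 6+2h t₃

  corners-odd : Out z → HasParity 1 z → Touches z 1 × Touches z 3 × Touches z k × Touches z (2 + k)
  corners-odd out r with corners 1 0 refl out r
  ... | t₀ , t₁ , t₂ , t₃ = t₀ , t₁ , at 5+2h t₂ , at 7+2h t₃

  -- A silent vertex is touched only by arcs into it, and the one from the lowest index of its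
  -- parity spreads upwards.
  full-in : ∀ p p′ q → p + p′ ≡ 1 → Out z → HasParity p z → (∀ j → j ≤ 2 + k → ¬ Arc D z (x j)) →
            p + (q + q) ≤ 2 + k → Arc D (x (p + (q + q))) z
  full-in {z} p p′ q pp out r silent q≤ =
    only-in q≤ (up≤ p 0 q out q≤ z≤n (only-in p≤ (proj₁ (corners p p′ pp out r))))
    where
    p≤ : p + 0 ≤ 2 + k
    p≤ = ≤-trans (+-monoʳ-≤ p z≤n) q≤
    only-in : ∀ {j} → j ≤ 2 + k → Touches z j → Arc D (x j) z
    only-in j≤ (inj₁ f) = ⊥-elim (silent _ j≤ f)
    only-in _  (inj₂ g) = g

  module OppositeParities {z w : Fin n} (z-out : Out z) (w-out : Out w) (z≢w : z ≢ w)
           (¬zw : ¬ Adjacent D z w) (z-even : HasParity 0 z) (w-odd : HasParity 1 w) where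

    private
      no-link : ∀ i j → i + (3 + (h + h)) ≡ j → j ≤ 2 + k → Arc D z (x i) → ¬ Arc D (x j) w
      no-link i j e j≤ f f′ = ¬zw (link i j z-out w-out z≢w e j≤ f f′)

      no-link′ : ∀ i j → i + (3 + (h + h)) ≡ j → j ≤ 2 + k → Arc D w (x i) → ¬ Arc D (x j) z
      no-link′ i j e j≤ f f′ = ¬zw (swap (link i j w-out z-out (λ w≡z → z≢w (sym w≡z)) e j≤ f f′))

      out-of : ∀ {v j} → Touches v j → ¬ Arc D (x j) v → Arc D v (x j)
      out-of (inj₁ f) _  = f
      out-of (inj₂ g) ¬g = ⊥-elim (¬g g)

      into : ∀ {v j} → Touches v j → ¬ Arc D v (x j) → Arc D (x j) v
      into (inj₁ f) ¬f = ⊥-elim (¬f f)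
      into (inj₂ g) _  = g

    -- Directions at the corners are forced in turn, alternately at w and z: `via` excludes arcs to
    -- distant vertices, `no-link` excludes arcs k - 2 apart. Opposite arcs may coexist, so w → x_1
    -- must still be excluded at the end.
    no-arcs-to-path : Arc D (x 1) w → NoArcTo 0 z × NoArcTo 1 w
    no-arcs-to-path 1→w with corners-even z-out z-even | corners-odd w-out w-odd
    ... | z₀ , z₂ , z₄ , z₆ | w₁ , w₃ , w₅ , _ = silent-z , silent-w
      where
      k→w : Arc D (x k) w
      k→w = into w₅ λ f → (lin-⊥ ((via 1 k 1≤ k≤ 1→w f) ⊹ ≤-reflexive (sym k≡)) (1 + h + h)
          (solve (h ∷ˡ k ∷ˡ []ˡ)))
      z↛2 : ¬ Arc D z (x 2)
      z↛2 f = no-link 2 k 2+3+2h k≤ f k→w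
      2→z : Arc D (x 2) z
      2→z = into z₂ z↛2
      1+k→z : Arc D (x (1 + k)) z
      1+k→z = into z₆ λ f → (lin-⊥ ((via 2 (1 + k) 2≤ 1+k≤ 2→z f) ⊹ ≤-reflexive (sym k≡)) (1 + h + h)
          (solve (h ∷ˡ k ∷ˡ []ˡ)))
      w↛3 : ¬ Arc D w (x 3)
      w↛3 f = no-link′ 3 (1 + k) 3+3+2h 1+k≤ f 1+k→z
      3→w : Arc D (x 3) w
      3→w = into w₃ w↛3
      k-2→w : Arc D (x (3 + (h + h))) w
      k-2→w = into (at 3+2h (up≤ 1 1 (1 + h) w-out k-2≤ (s≤s z≤n) 3→w))
        -- The arc w → x_{k-2} would give k - 2 ≤ 3, so k = 5 and it is the excluded arc w → x_3.
        λ f → w↛3 (subst (λ j → Arc D w (x j)) (≤-antisym (via 1 (3 + (h + h)) 1≤ 3+2h≤ 1→w f) (m≤m+n 3 (h + h))) f)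
        where
        k-2≤ : 1 + ((1 + h) + (1 + h)) ≤ 2 + k
        k-2≤ = lin (≤-reflexive (sym k≡)) 4 (solve (h ∷ˡ k ∷ˡ []ˡ))
      z↛0 : ¬ Arc D z (x 0)
      z↛0 f = no-link 0 (3 + (h + h)) refl 3+2h≤ f k-2→w
      0→z : Arc D (x 0) z
      0→z = into z₀ z↛0
      w↛1 : ¬ Arc D w (x 1)
      w↛1 f = no-link′ 1 (4 + (h + h)) refl 4+2h≤ f
        (into z₄ λ f′ → (lin-⊥ (via 0 (4 + (h + h)) z≤n 4+2h≤ 0→z f′) (1 + h + h) (solve (h ∷ˡ []ˡ))))
      silent-z : NoArcTo 0 z
      silent-z zero          j refl j≤ f = z↛0 f
      silent-z (suc zero)    j refl j≤ f = z↛2 f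
      silent-z (suc (suc q)) j e    j≤ f =
        (lin-⊥ ((via 0 j z≤n j≤ 0→z f) ⊹ ≤-reflexive e) (1 + q + q) (solve (j ∷ˡ q ∷ˡ []ˡ)))
      silent-w : NoArcTo 1 w
      silent-w zero          j refl j≤ f = w↛1 f
      silent-w (suc zero)    j refl j≤ f = w↛3 f
      silent-w (suc (suc q)) j e    j≤ f =
        (lin-⊥ ((via 1 j 1≤ j≤ 1→w f) ⊹ ≤-reflexive e) (1 + q + q) (solve (j ∷ˡ q ∷ˡ []ˡ)))

    -- Directions are forced until z → x_2 and x_k → w appear, which are k - 2 apart.
    ends-conflict : Arc D w (x 1) → Arc D (x (1 + k)) z → ⊥
    ends-conflict w→1 1+k→z with corners-even z-out z-even | corners-odd w-out w-odd
    ... | z₀ , z₂ , z₄ , z₆ | w₁ , w₃ , w₅ , _ = no-link 2 k 2+3+2h k≤ z→2 (into w₅ w↛k)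
      where
      z→4 : Arc D z (x (4 + (h + h)))
      z→4 = out-of z₄ (no-link′ 1 (4 + (h + h)) refl 4+2h≤ w→1)
      3→w : Arc D (x 3) w
      3→w = into w₃ λ f → no-link′ 3 (1 + k) 3+3+2h 1+k≤ f 1+k→z
      z→0 : Arc D z (x 0)
      z→0 = out-of z₀ λ g → (lin-⊥ (via 0 (4 + (h + h)) z≤n 4+2h≤ g z→4) (1 + h + h) (solve (h ∷ˡ []ˡ)))
      -- For k = 5 the bound of `via` can be attained, but then z → x_0 and x_3 → w are already k -
      -- 2 apart.
      h≰0 : h + h ≤ 0 → ⊥
      h≰0 h+h≤0 = no-link 0 3 (cong (3 +_) (n≤0⇒n≡0 h+h≤0)) 3≤ z→0 3→w
      z→2 : Arc D z (x 2)
      z→2 = out-of z₂ λ g → h≰0 (lin (via 2 (4 + (h + h)) 2≤ 4+2h≤ g z→4) 0 (solve (h ∷ˡ []ˡ)))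
      w↛k : ¬ Arc D w (x k)
      w↛k f = h≰0 (lin ((via 3 k 3≤ k≤ 3→w f) ⊹ ≤-reflexive (sym k≡)) 0 (solve (h ∷ˡ k ∷ˡ []ˡ)))

    out-at-1 : ¬ Arc D (x 1) w → Arc D w (x 1)
    out-at-1 = out-of (proj₁ (corners-odd w-out w-odd))

    in-at-1+k : ¬ Arc D z (x (1 + k)) → Arc D (x (1 + k)) z
    in-at-1+k = into (proj₂ (proj₂ (proj₂ (corners-even z-out z-even))))

-- Vertices of both parities and their bridges

module MixedVertices {n k} (h : ℕ) (k≡ : k ≡ 5 + (h + h)) {D : Digraph (Fin n)} (G : Geodesic D k) where

  open Pairs h k≡ G public

  private
    module Op = Pairs h k≡ (opposite-geodesic G)
    variable
      z w : Fin n

  no-arc-from-op : ∀ p p′ → p + p′ ≡ 1 → Op.NoArcTo p′ z → NoArcFrom p z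
  no-arc-from-op p p′ pp silent q j refl j≤ g with opposite-half p q j≤
  ... | q′ , e = silent q′ (p′ + (q′ + q′)) refl (opposite-index≤ p p′ q q′ pp e)
    (arc-from-op (p′ + (q′ + q′)) (p + (q + q)) (opposite-index p p′ q q′ pp e) g)

  nonadjacent : Out z → Out w → z ≢ w → ¬ Adjacent D z w → HasParity 0 z → HasParity 1 w →
                (NoArcTo 0 z × NoArcTo 1 w) ⊎ (NoArcFrom 0 z × NoArcFrom 1 w)
  nonadjacent {z} {w} z-out w-out z≢w ¬zw z-even w-odd with arc? D (x 1) w | arc? D z (x (1 + k))
  ... | yes 1→w | _        = inj₁ (no-arcs-to-path 1→w)
    where open OppositeParities z-out w-out z≢w ¬zw z-even w-odd
  ... | no 1↛w  | no z↛1+k = ⊥-elim (ends-conflict (out-at-1 1↛w) (in-at-1+k z↛1+k))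
    where open OppositeParities z-out w-out z≢w ¬zw z-even w-odd
  -- Under reversal z → x_{k+1} becomes an arc from index 1 to z. Parities are exchanged, and with
  -- them the roles of z and w.
  ... | no _    | yes z→1+k = from-op (no-arcs-to-path z→1+k)
    where
    open Op.OppositeParities (out-op w-out) (out-op z-out) (λ w≡z → z≢w (sym w≡z)) ¬zw
           (has-parity-op 1 0 refl w-odd) (has-parity-op 0 1 refl z-even)
    from-op : Op.NoArcTo 0 w × Op.NoArcTo 1 z →
              (NoArcTo 0 z × NoArcTo 1 w) ⊎ (NoArcFrom 0 z × NoArcFrom 1 w)
    from-op (w-silent , z-silent) =
      inj₂ (no-arc-from-op 0 1 refl z-silent , no-arc-from-op 1 0 refl w-silent)

  -- Note 3 + (h + h) = k - 2.
  Bridge : Fin n → Set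
  Bridge z = ∃[ b ] b ≤ 4 × Arc D (x (b + (3 + (h + h)))) z × Arc D z (x b)

  HasArcTo HasArcFrom : Fin n → Set
  HasArcTo   z = ∃[ i ] i ≤ 2 + k × Arc D z (x i)
  HasArcFrom z = ∃[ i ] i ≤ 2 + k × Arc D (x i) z

  private
    2≤ : 2 ≤ 2 + k
    2≤ = s≤s (s≤s z≤n)
    k≤ : k ≤ 2 + k
    k≤ = m≤n+m k 2
    1+k≤ : 1 + k ≤ 2 + k
    1+k≤ = n≤1+n _
    3≤ : 3 ≤ 2 + k
    3≤ = lin (≤-reflexive (sym k≡)) (4 + h + h) (solve (h ∷ˡ k ∷ˡ []ˡ))
    4≤ : 4 ≤ 2 + k
    4≤ = lin (≤-reflexive (sym k≡)) (3 + h + h) (solve (h ∷ˡ k ∷ˡ []ˡ))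

  -- The values b = 2, 3, 4 are tried in turn; a missing arc x_{b+k-2} → z leaves z → x_{b+k-2}.
  -- After the last failure z → x_N forces every arc x_a → z to have a ≥ k, so x_a is the upper end
  -- of one of these bridges. The values b = 0, 1 arise here only for k = 5.
  bridge-from-2 : Out z → HasParity 0 z → HasParity 1 z → HasArcFrom z → Arc D z (x 2) → Bridge z
  bridge-from-2 {z} out even odd (a , a≤ , a→z) z→2 with corners-even out even | corners-odd out odd
  ... | z₀ , _ , _ , z₆ | z₁ , z₃ , z₅ , z₇ = case-k z₅
    where
    bridge : ∀ b j → b ≤ 4 → j ≡ b + (3 + (h + h)) → Arc D (x j) z → Arc D z (x b) → Bridge z
    bridge b j b≤4 refl g f = b , b≤4 , g , f
    bridge₂ : Arc D (x k) z → Bridge z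
    bridge₂ g = bridge 2 k (s≤s (s≤s z≤n)) k≡ g z→2
    bridge₃ : Arc D z (x 3) → Arc D (x (1 + k)) z → Bridge z
    bridge₃ f g = bridge 3 (1 + k) (s≤s (s≤s (s≤s z≤n))) (cong suc k≡) g f
    bridge₄ : Arc D z (x 4) → Arc D (x (2 + k)) z → Bridge z
    bridge₄ f g = bridge 4 (2 + k) ≤-refl (cong (2 +_) k≡) g f
    case-last : Arc D z (x 3) → Arc D z (x 4) → Touches z (2 + k) → Bridge z
    case-last z→3 z→4 (inj₂ g) = bridge₄ z→4 g
    case-last z→3 z→4 (inj₁ f) with ≤⇒∃ {k} {a} (lin (via a (2 + k) a≤ ≤-refl a→z f) 0
        (solve (a ∷ˡ k ∷ˡ []ˡ)))
    ... | 0           , e = bridge₂ (arc-at (trans (sym e) (+-identityʳ k)) a→z)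
    ... | 1           , e = bridge₃ z→3 (arc-at (trans (sym e) (+-comm k 1)) a→z)
    ... | 2           , e = bridge₄ z→4 (arc-at (trans (sym e) (+-comm k 2)) a→z)
    ... | suc (suc (suc d)) , e = lin-⊥ (≤-reflexive e ⊹ a≤) d (solve (a ∷ˡ d ∷ˡ k ∷ˡ []ˡ))
    h+h≡0 : h + h ≤ 0 → ∀ b → b ≡ b + (h + h)
    h+h≡0 h≤0 b = sym (trans (cong (b +_) (n≤0⇒n≡0 h≤0)) (+-identityʳ b))
    case-4 : Arc D z (x 3) → Arc D z (x k) → Arc D z (x (1 + k)) → Touches z 4 → Bridge z
    case-4 z→3 _   _     (inj₁ z→4) = case-last z→3 z→4 z₇
    case-4 z→3 z→k z→1+k (inj₂ 4→z) = case-1 z₁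
      where
      case-1 : Touches z 1 → Bridge z
      case-1 (inj₁ f) = bridge 1 4 (s≤s z≤n) (h+h≡0 (lin ((via 4 (1 + k) 4≤ 1+k≤ 4→z z→1+k) ⊹ ≤-reflexive (sym k≡)) 0
          (solve (h ∷ˡ k ∷ˡ []ˡ))) 4) 4→z f
      case-1 (inj₂ g) = lin-⊥ ((via 1 k (s≤s z≤n) k≤ g z→k) ⊹ ≤-reflexive (sym k≡)) (1 + h + h)
          (solve (h ∷ˡ k ∷ˡ []ˡ))
    case-1+k : Arc D z (x 3) → Arc D z (x k) → Touches z (1 + k) → Bridge z
    case-1+k z→3 z→k (inj₂ g) = bridge₃ z→3 g
    case-1+k z→3 z→k (inj₁ f) = case-4 z→3 z→k f (down≤ 0 2 (3 + h) out 6+2h≤ (s≤s (s≤s z≤n))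
      (subst (λ j → Arc D z (x j)) 6+2h f))
      where
      6+2h : 1 + k ≡ (3 + h) + (3 + h)
      6+2h = lin-≡ k≡ (solve (h ∷ˡ k ∷ˡ []ˡ))
      6+2h≤ : (3 + h) + (3 + h) ≤ 2 + k
      6+2h≤ = subst (_≤ 2 + k) 6+2h 1+k≤
    case-3 : Arc D z (x k) → Touches z 3 → Bridge z
    case-3 z→k (inj₁ f) = case-1+k f z→k z₆
    case-3 z→k (inj₂ 3→z) = case-0 z₀
      where
      case-0 : Touches z 0 → Bridge z
      case-0 (inj₁ f) = bridge 0 3 z≤n (h+h≡0 (lin ((via 3 k 3≤ k≤ 3→z z→k) ⊹ ≤-reflexive (sym k≡)) 0
          (solve (h ∷ˡ k ∷ˡ []ˡ))) 3) 3→z f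
      case-0 (inj₂ g) = lin-⊥ ((via 0 k z≤n k≤ g z→k) ⊹ ≤-reflexive (sym k≡)) (2 + h + h)
          (solve (h ∷ˡ k ∷ˡ []ˡ))
    case-k : Touches z k → Bridge z
    case-k (inj₁ f) = case-3 f z₃
    case-k (inj₂ g) = bridge₂ g

-- Spreading both parities with a bridge

next-parity : ∀ p p′ q → p + p′ ≡ 1 → ∃[ q′ ] p′ + (q′ + q′) ≡ suc (p + (q + q))
next-parity zero       .1 q refl = q , refl
next-parity (suc zero) zero q _  = suc q , cong suc (+-suc q q)

previous-parity : ∀ p p′ q i → p + p′ ≡ 1 → p + (q + q) ≡ suc i → ∃[ q′ ] p′ + (q′ + q′) ≡ i
previous-parity zero       .1   (suc q) i refl e = q , suc-injective (trans (cong suc (sym (+-suc q q))) e)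
previous-parity (suc zero) zero q       i _    e = q , suc-injective e

module Spreading {n k} (h : ℕ) (k≡ : k ≡ 5 + (h + h)) {D : Digraph (Fin n)} (G : Geodesic D k) where

  open MixedVertices h k≡ G public

  private
    module Op = MixedVertices h k≡ (opposite-geodesic G)
    variable
      z w : Fin n

  arc-to-from-op : ∀ i j → i + j ≡ 2 + k → Arc D z (Op.x i) → Arc D z (x j)
  arc-to-from-op i j e = subst (Arc D _) (mirror G i j e)

  arc-from-from-op : ∀ i j → i + j ≡ 2 + k → Arc D (Op.x i) z → Arc D (x j) z
  arc-from-from-op i j e = subst (λ v → Arc D v _) (mirror G i j e)

  has-arc-to-op : HasArcTo z → Op.HasArcFrom z
  has-arc-to-op (i , i≤ , f) with ≤⇒∃ i≤
  ... | i′ , e = i′ , subst (i′ ≤_) e (m≤n+m i′ i) , arc-to-op i′ i (trans (+-comm i′ i) e) f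

  bridge-from-op : Op.Bridge z → Bridge z
  bridge-from-op (b , b≤4 , f , g) with ≤⇒∃ b≤4
  ... | b′ , e = b′ , subst (b′ ≤_) e (m≤n+m b′ b)
      , arc-from-from-op b (b′ + (3 + (h + h))) (lin-≡ (e ⊞ sym k≡)
          (solve (b ∷ˡ b′ ∷ˡ h ∷ˡ k ∷ˡ []ˡ))) g
      , arc-to-from-op (b + (3 + (h + h))) b′ (lin-≡ (e ⊞ sym k≡) (solve (b ∷ˡ b′ ∷ˡ h ∷ˡ k ∷ˡ []ˡ))) f

  -- Since x_2 → z → x_k would be too short, x_2 → z leaves only x_k → z, which reversal turns into
  -- an arc from z to index 2.
  bridge : Out z → HasParity 0 z → HasParity 1 z → HasArcFrom z → HasArcTo z → Bridge z
  bridge {z} out even odd from to =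
    case (proj₁ (proj₂ (corners-even out even))) (proj₁ (proj₂ (proj₂ (corners-odd out odd))))
    where
    case : Touches z 2 → Touches z k → Bridge z
    case (inj₁ f) _        = bridge-from-2 out even odd from f
    case (inj₂ g) (inj₁ f) = lin-⊥ ((via 2 k (s≤s (s≤s z≤n)) (m≤n+m k 2) g f) ⊹ ≤-reflexive (sym k≡)) (h + h)
        (solve (h ∷ˡ k ∷ˡ []ˡ))
    case (inj₂ g) (inj₂ f) = bridge-from-op (Op.bridge-from-2 (out-op out)
      (has-parity-op 1 0 refl odd) (has-parity-op 0 1 refl even) (has-arc-to-op to) (arc-from-op 2 k refl f))

  module _ (z-out : Out z) (w-out : Out w) (z≢w : z ≢ w) (br : Bridge z) where

    private
      b a : ℕ
      b = proj₁ br
      a = b + (3 + (h + h))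
      b≤4 : b ≤ 4
      b≤4 = proj₁ (proj₂ br)
      a≤ : a ≤ 2 + k
      a≤ = ≤-trans (+-monoˡ-≤ (3 + (h + h)) b≤4) (≤-reflexive (cong (2 +_) (sym k≡)))

    Detour : ℕ → ℕ → Fin n → Set
    Detour i j v = Segment i a v ⊎ (v ≡ z ⊎ Below (suc j) v)

    detour : ∀ i j d e → i + d ≡ a → b + e ≡ j → j < i → i ≤ a →
             Trail D (Detour i j) (x i) (x j) (d + suc (0 + suc e))
    detour i j d e i+d b+e j<i i≤a =
      join (segment i d a i+d a≤) (proj₁ (proj₂ (proj₂ br)))
        (join (point {S = _≡ z} refl) (proj₂ (proj₂ (proj₂ br))) (run b e j b+e j≤)
          λ { refl (m , m<j , eq) → z-out (m , ≤-trans m<j (s≤s j≤) , eq) })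
        λ { (m , _ , m≤a , eq) (inj₁ refl) → z-out (m , s≤s (≤-trans m≤a a≤) , eq)
          ; s (inj₂ t) → segment∩below a≤ j<i s t }
      where
      j≤ : j ≤ 2 + k
      j≤ = ≤-trans (<⇒≤ (≤-trans j<i i≤a)) a≤

    off-detour : ∀ {i j} → j < i → i ≤ a → ¬ Detour i j w
    off-detour j<i i≤a (inj₁ (m , _ , m≤a , eq))        = w-out (m , s≤s (≤-trans m≤a a≤) , eq)
    off-detour j<i i≤a (inj₂ (inj₁ w≡z))                = z≢w (sym w≡z)
    off-detour j<i i≤a (inj₂ (inj₂ (m , m<j , eq))) =
      w-out (m , ≤-trans m<j (≤-trans j<i (≤-trans i≤a (≤-trans a≤ (n≤1+n _)))) , eq)

    detour-length : ∀ {i d e} → suc i + d ≡ a → b + e ≡ i → suc (d + suc (suc e)) ≡ k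
    detour-length {i} {d} {e} p q = go b p q
      where
      go : ∀ b → suc i + d ≡ b + (3 + (h + h)) → b + e ≡ i → suc (d + suc (suc e)) ≡ k
      go b p q = lin-≡ (p ⊞ q ⊞ sym k≡) (solve (b ∷ˡ d ∷ˡ e ∷ˡ h ∷ˡ i ∷ˡ k ∷ˡ []ˡ))

    -- The route x_{i+1} ... x_a, z, x_b ... x_i is the k-cycle of the bridge without the arc x_i →
    -- x_{i+1}. Its k - 1 arcs and the arc at w form a path of k arcs.
    touches-neighbour : ∀ i → b ≤ i → suc i ≤ a →
                        (Arc D w (x (suc i)) → Touches w i) × (Arc D (x i) w → Touches w (suc i))
    touches-neighbour i b≤i i<a with ≤⇒∃ b≤i | ≤⇒∃ i<a
    ... | e , b+e | d , i+d =
        (λ f → quasi-trail (join (point {S = _≡ w} refl) f route λ { refl s → off-detour ≤-refl i<a s })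
          (detour-length i+d b+e))
      , (λ g → swap (quasi-trail (join route g (point {S = _≡ w} refl) λ { s refl → off-detour ≤-refl i<a s })
          (trans (+-comm _ 1) (detour-length i+d b+e))))
      where
      route : Trail D (Detour (suc i) i) (x (suc i)) (x i) (d + suc (0 + suc e))
      route = detour (suc i) i d e i+d b+e ≤-refl i<a

    -- Strictly inside the bridge both neighbours of an index are available; the direction of the
    -- arc at w decides which one is reached.
    opposite-parity-between : ∀ p p′ q → p + p′ ≡ 1 → b < p + (q + q) → p + (q + q) < a →
                              Touches w (p + (q + q)) → HasParity p′ w
    opposite-parity-between p p′ q pp b<i i<a (inj₂ g) with next-parity p p′ q pp
    ... | q′ , e = has-parity p′ q′ (suc (p + (q + q))) e (≤-trans i<a a≤)
                     (proj₂ (touches-neighbour (p + (q + q)) (<⇒≤ b<i) i<a) g)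
    opposite-parity-between p p′ q pp b<i i<a (inj₁ f) with ≤⇒∃ b<i
    ... | d , b+d with previous-parity p p′ q (b + d) pp (sym b+d)
    ...   | q′ , e = has-parity p′ q′ (b + d) e (≤-trans (<⇒≤ (<-trans (subst (b + d <_) b+d ≤-refl) i<a)) a≤)
      (proj₁ (touches-neighbour (b + d) (m≤m+n b d) (subst (_≤ a) (sym b+d) (<⇒≤ i<a)))
        (subst (λ i → Arc D w (x i)) (sym b+d) f))

  -- Every possible bridge, from x_{b+k-2} to x_b, leaves a corner of each parity strictly between
  -- its ends.
  spread : ∀ p p′ → p + p′ ≡ 1 → Out z → Out w → z ≢ w → Bridge z → HasParity p w → HasParity p′ w
  spread {z} {w} p p′ pp z-out w-out z≢w br r = pick p p′ pp br (corners p p′ pp w-out r)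
    where
    between : ∀ p p′ q → p + p′ ≡ 1 → (br : Bridge z) → proj₁ br < p + (q + q) →
              p + (q + q) < proj₁ br + (3 + (h + h)) → Touches w (p + (q + q)) → HasParity p′ w
    between p p′ q pp br = opposite-parity-between z-out w-out z≢w br p p′ q pp
    pick : ∀ p p′ → p + p′ ≡ 1 → Bridge z → CornerSet p w → HasParity p′ w
    pick 0 .1 refl br@(0 , _) (_ , t , _) = between 0 1 1 refl br (s≤s z≤n) (lin (z≤n {0}) (h + h)
        (solve (h ∷ˡ []ˡ))) t
    pick 0 .1 refl br@(1 , _) (_ , t , _) = between 0 1 1 refl br (s≤s (s≤s z≤n)) (lin (z≤n {0}) (1 + h + h)
        (solve (h ∷ˡ []ˡ))) t
    pick 0 .1 refl br@(2 , _) (_ , _ , t , _) = between 0 1 (2 + h) refl br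
      (lin (z≤n {0}) (1 + h + h) (solve (h ∷ˡ []ˡ))) (lin (z≤n {0}) 0 (solve (h ∷ˡ []ˡ))) t
    pick 0 .1 refl br@(3 , _) (_ , _ , t , _) = between 0 1 (2 + h) refl br
      (lin (z≤n {0}) (h + h) (solve (h ∷ˡ []ˡ))) (lin (z≤n {0}) 1 (solve (h ∷ˡ []ˡ))) t
    pick 0 .1 refl br@(4 , _) (_ , _ , _ , t) = between 0 1 (3 + h) refl br
      (lin (z≤n {0}) (1 + h + h) (solve (h ∷ˡ []ˡ))) (lin (z≤n {0}) 0 (solve (h ∷ˡ []ˡ))) t
    pick 1 0 refl br@(0 , _) (t , _) = between 1 0 0 refl br (s≤s z≤n) (lin (z≤n {0}) (1 + h + h)
        (solve (h ∷ˡ []ˡ))) t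
    pick 1 0 refl br@(1 , _) (_ , t , _) = between 1 0 1 refl br (s≤s (s≤s z≤n)) (lin (z≤n {0}) (h + h)
        (solve (h ∷ˡ []ˡ))) t
    pick 1 0 refl br@(2 , _) (_ , t , _) = between 1 0 1 refl br (s≤s (s≤s (s≤s z≤n))) (lin (z≤n {0}) (1 + h + h)
        (solve (h ∷ˡ []ˡ))) t
    pick 1 0 refl br@(3 , _) (_ , _ , t , _) = between 1 0 (2 + h) refl br
      (lin (z≤n {0}) (1 + h + h) (solve (h ∷ˡ []ˡ))) (lin (z≤n {0}) 0 (solve (h ∷ˡ []ˡ))) t
    pick 1 0 refl br@(4 , _) (_ , _ , t , _) = between 1 0 (2 + h) refl br
      (lin (z≤n {0}) (h + h) (solve (h ∷ˡ []ˡ))) (lin (z≤n {0}) 1 (solve (h ∷ˡ []ˡ))) t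
    pick _ _ _ (suc (suc (suc (suc (suc b)))) , s≤s (s≤s (s≤s (s≤s ()))) , _) _

-- Distances to the path

module Distances {n k} (h : ℕ) (k≡ : k ≡ 5 + (h + h)) {D : Digraph (Fin n)} (G : Geodesic D k)
                 (connected : ∀ a b → ∃[ ℓ ] Walk D a b ℓ) where

  open Spreading h k≡ G public

  private
    module Op = Spreading h k≡ (opposite-geodesic G)
    variable
      r : ℕ
      z w : Fin n

  Silent Deaf : Fin n → Set
  Silent z = ∀ j → j ≤ 2 + k → ¬ Arc D z (x j)
  Deaf   z = ∀ j → j ≤ 2 + k → ¬ Arc D (x j) z

  -- The number of arcs is exact; minimality is imposed only in `Dist`, where 0 means lying on the
  -- path.
  Reach : ℕ → Fin n → Set
  Reach zero    z = Below (3 + k) z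
  Reach (suc m) z = ∃[ y ] Arc D z y × Reach m y

  below? : ∀ z → Dec (Below (3 + k) z)
  below? z = anyUpTo? (λ m → z Fin.≟ x m) (3 + k)

  reach? : ∀ m z → Dec (Reach m z)
  reach? zero    z = below? z
  reach? (suc m) z = Fin.any? (λ y → arc? D z y ×-dec reach? m y)

  Dist : ℕ → Fin n → Set
  Dist m z = Reach m z × (∀ m′ → m′ < m → ¬ Reach m′ z)

  least : ∀ b m → m ≤ b → Reach m z → ∃[ m′ ] Dist m′ z
  least {z} b m m≤b r with anyUpTo? (λ m′ → reach? m′ z) m
  least b       m m≤b r | no none = m , r , λ m′ m′<m r′ → none (m′ , m′<m , r′)
  least zero    m m≤b r | yes (m′ , m′<m , r′) = ⊥-elim (n≮0 (≤-trans m′<m m≤b))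
  least (suc b) m m≤b r | yes (m′ , m′<m , r′) = least b m′ (≤-pred (≤-trans m′<m m≤b)) r′

  walk⇒reach : Walk D z (x 0) ℓ → Reach ℓ z
  walk⇒reach [ _ ]   = 0 , s≤s z≤n , refl
  walk⇒reach (e ∷ w) = _ , e , walk⇒reach w

  distance : ∀ z → Out z → ∃[ m ] Dist (suc m) z
  distance z out with connected z (x 0)
  ... | ℓ , w with least ℓ ℓ ≤-refl (walk⇒reach w)
  ...   | zero  , r , _ = ⊥-elim (out r)
  ...   | suc m , d     = m , d

  dist≤ : Dist m z → Reach r z → m ≤ r
  dist≤ (_ , min) r = ≮⇒≥ λ r<m → min _ r<m r

  nearer : Dist (suc m) z → ∃[ y ] Arc D z y × Dist m y
  nearer ((y , f , r) , min) = y , f , r , λ m′ m′<m r′ → min (suc m′) (s≤s m′<m) (y , f , r′)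

  dist-out : Dist (suc m) z → Out z
  dist-out (_ , min) = min 0 (s≤s z≤n)

  dist-silent : Dist (suc (suc m)) z → Silent z
  dist-silent (_ , min) j j≤ f = min 1 (s≤s (s≤s z≤n)) (x j , f , j , s≤s j≤ , refl)

  dist-1 : Dist 1 z → HasArcTo z
  dist-1 ((_ , f , j , j< , refl) , _) = j , ≤-pred j< , f

  -- Vertices of a shortest exit, described by their distances to the path. The distances alone show
  -- that they are off the path if `lo` is positive, and that they differ from a vertex whose
  -- distance is outside the range.
  Approach : Fin n → ℕ → ℕ → Fin n → Set
  Approach z lo hi v = v ≡ z ⊎ ∃[ d ] lo ≤ d × d < hi × Dist d v

  approach : ∀ m r → Dist (m + r) z → ∃[ y ] Dist r y × Trail D (Approach z r (m + r)) z y m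
  approach {z} zero    r d = z , d , point (inj₁ refl)
  approach {z} (suc m) r d with nearer d
  ... | y , f , d′ with approach m r d′
  ...   | y′ , d″ , t = y′ , d″ , widen merge (join (point {S = _≡ z} refl) f t
      λ { refl (inj₁ refl) → 1+n≰n (dist≤ d (proj₁ d′))
        ; refl (inj₂ (e , _ , e< , de)) → 1+n≰n (≤-trans (≤-trans (dist≤ d (proj₁ de)) (<⇒≤ e<)) ≤-refl) })
    where
    merge : ∀ {v} → v ≡ z ⊎ Approach y r (m + r) v → Approach z r (suc m + r) v
    merge (inj₁ eq)                       = inj₁ eq
    merge (inj₂ (inj₁ refl))              = inj₂ (m + r , m≤n+m r m , ≤-refl , d′)
    merge (inj₂ (inj₂ (e , r≤e , e< , de))) = inj₂ (e , r≤e , m≤n⇒m≤1+n e< , de)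

  approach-out : ∀ {hi v} → Out z → Approach z (suc r) hi v → Out v
  approach-out out (inj₁ refl)                  = out
  approach-out out (inj₂ (suc e , _ , _ , de)) = dist-out de

  -- Moves along the cycle closed by x_N → x_0. As L ≤ k - 1 is less than its length, the part after
  -- the wrap ends below x_i.
  extend : ∀ i L → i ≤ 2 + k → L ≤ 4 + (h + h) →
           ∃[ j ] j ≤ 2 + k × Trail D (Below (3 + k)) (x i) (x j) L × (i + L ≡ j ⊎ i + L ≡ j + (3 + k))
  extend i L i≤ L≤ = case (i + L ≤? 2 + k)
    where
    Extension : Set
    Extension = ∃[ j ] j ≤ 2 + k × Trail D (Below (3 + k)) (x i) (x j) L × (i + L ≡ j ⊎ i + L ≡ j + (3 + k))
    wrap : 2 + k < i + L → ∃[ d ] i + d ≡ 2 + k → Extension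
    wrap N< (d , e) = wrap′ (≤⇒∃ {suc d} {L} (lin (≤-reflexive e ⊹ N<) 0
        (solve (L ∷ˡ d ∷ˡ i ∷ˡ k ∷ˡ []ˡ))))
      where
      wrap′ : ∃[ m ] suc d + m ≡ L → Extension
      wrap′ (m , e′) = m , m≤
        , subst (Trail D _ _ _) (trans (+-suc d m) e′)
            (jump i d (2 + k) e ≤-refl back-all (run 0 m m refl m≤)
              (lin (≤-reflexive (sym e) ⊹ ≤-reflexive e′ ⊹ L≤ ⊹ ≤-reflexive (sym k≡)) 3
                  (solve (L ∷ˡ d ∷ˡ h ∷ˡ i ∷ˡ k ∷ˡ m ∷ˡ []ˡ))))
        , inj₂ (lin-≡ (e ⊞ sym e′) (solve (L ∷ˡ d ∷ˡ i ∷ˡ k ∷ˡ m ∷ˡ []ˡ)))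
        where
        m≤ : m ≤ 2 + k
        m≤ = lin (≤-reflexive e′ ⊹ L≤ ⊹ ≤-reflexive (sym k≡)) (4 + d)
            (solve (L ∷ˡ d ∷ˡ h ∷ˡ k ∷ˡ m ∷ˡ []ˡ))
    case : Dec (i + L ≤ 2 + k) → Extension
    case (yes ≤N) = i + L , ≤N , lower (s≤s ≤N) (run i L (i + L) refl ≤N) , inj₁ refl
    case (no ≰N)  = wrap (≰⇒> ≰N) (≤⇒∃ i≤)

  some-parity : ∀ {j} → j ≤ 2 + k → Touches z j → HasParity 0 z ⊎ HasParity 1 z
  some-parity {j = j} j≤ t with parity j
  ... | zero     , q , _ , e = inj₁ (has-parity 0 q j e j≤ t)
  ... | suc zero , q , _ , e = inj₂ (has-parity 1 q j e j≤ t)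
  ... | suc (suc _) , _ , s≤s () , _

  Attached : Fin n → Set
  Attached z = HasParity 0 z ⊎ HasParity 1 z

  -- Otherwise x_p → z → w → x_{p′+k+1} would be too short a detour.
  silent↛deaf : Out z → Out w → Attached z → Attached w → Silent z → Deaf w → ¬ Arc D z w
  silent↛deaf {z} {w} z-out w-out z-att w-att silent deaf f = go z-att w-att
    where
    start : ∀ p p′ → p + p′ ≡ 1 → HasParity p z → Arc D (x (p + 0)) z
    start p p′ pp r = full-in p p′ 0 pp z-out r silent
      (subst (_≤ 2 + k) (sym (+-identityʳ p)) (≤-trans (subst (p ≤_) pp (m≤m+n p p′)) (s≤s z≤n)))
    finish : ∀ p p′ → p + p′ ≡ 1 → HasParity p w → p + ((3 + h) + (3 + h)) ≤ 2 + k → Arc D w (x (p + ((3 + h) + (3 + h))))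
    finish p p′ pp r p≤ with proj₂ (proj₂ (proj₂ (corners p p′ pp w-out r)))
    ... | inj₁ f′ = f′
    ... | inj₂ g  = ⊥-elim (deaf _ p≤ g)
    clash : ∀ p p′ q q′ → p + p′ ≡ 1 → q + q′ ≡ 1 → HasParity p z → HasParity q w → ⊥
    clash p p′ q q′ pp qq r s = lin-⊥ (bound ⊹ ≤-reflexive pp) (1 + q + h + h + p′)
        (solve (h ∷ˡ p ∷ˡ p′ ∷ˡ q ∷ˡ []ˡ))
      where
      q≤ : q + ((3 + h) + (3 + h)) ≤ 2 + k
      q≤ = lin (≤-reflexive qq ⊹ ≤-reflexive (sym k≡)) q′ (solve (h ∷ˡ k ∷ˡ q ∷ˡ q′ ∷ˡ []ˡ))
      bound : q + ((3 + h) + (3 + h)) ≤ p + 0 + 3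
      bound = short (p + 0) (q + ((3 + h) + (3 + h))) (lin (≤-reflexive pp) (1 + k + p′)
          (solve (k ∷ˡ p ∷ˡ p′ ∷ˡ []ˡ))) q≤
        (start p p′ pp r ∷ (f ∷ (finish q q′ qq s q≤ ∷ [ _ ])))
    go : Attached z → Attached w → ⊥
    go (inj₁ r) (inj₁ s) = clash 0 1 0 1 refl refl r s
    go (inj₁ r) (inj₂ s) = clash 0 1 1 0 refl refl r s
    go (inj₂ r) (inj₁ s) = clash 1 0 0 1 refl refl r s
    go (inj₂ r) (inj₂ s) = clash 1 0 1 0 refl refl r s

  -- The wrap-around x_N → x_0 shifts indices by 3 + k, which is even.
  extension-parity : ∀ p q i L j → p ≤ 1 → i + L ≡ p + (q + q) → i + L ≡ j ⊎ i + L ≡ j + (3 + k) →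
                     ∃[ q′ ] p + (q′ + q′) ≡ j
  extension-parity p q i L j p≤1 e (inj₁ e′) = q , trans (sym e) e′
  extension-parity p q i L j p≤1 e (inj₂ e′) = go (≤⇒∃ h+4≤q)
    where
    h+4≤q : h + 4 ≤ q
    h+4≤q = ≮⇒≥ {q} {h + 4} λ q<h+4 →
      (lin-⊥ (q<h+4 ⊹ q<h+4 ⊹ p≤1 ⊹ ≤-reflexive e ⊹ ≤-reflexive (sym e′) ⊹ ≤-reflexive (sym k≡)) j
          (solve (L ∷ˡ h ∷ˡ i ∷ˡ j ∷ˡ k ∷ˡ p ∷ˡ q ∷ˡ []ˡ)))
    go : ∃[ q′ ] h + 4 + q′ ≡ q → ∃[ q′ ] p + (q′ + q′) ≡ j
    go (q′ , c) = q′ , (lin-≡ (c ⊞ c ⊞ sym e ⊞ e′ ⊞ k≡)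
        (solve (L ∷ˡ h ∷ˡ i ∷ˡ j ∷ˡ k ∷ˡ p ∷ˡ q ∷ˡ q′ ∷ˡ []ˡ)))

  -- After z → w → x_i there remain k - 2 arcs round the cycle, an odd number.
  two-step : ∀ p p′ q → p + p′ ≡ 1 → Out z → Out w → z ≢ w → Arc D z w → p + (q + q) ≤ 2 + k →
             Arc D w (x (p + (q + q))) → HasParity p′ z
  two-step {z} {w} p p′ q pp z-out w-out z≢w f q≤ f′ = go (extend (p + (q + q)) (3 + (h + h)) q≤ (n≤1+n _))
    where
    total : p + (q + q) + (3 + (h + h)) ≡ p′ + ((p + q + 1 + h) + (p + q + 1 + h))
    total = lin-≡ (sym pp) (solve (h ∷ˡ p ∷ˡ p′ ∷ˡ q ∷ˡ []ˡ))
    go : ∃[ j ] j ≤ 2 + k × Trail D (Below (3 + k)) (x (p + (q + q))) (x j) (3 + (h + h)) ×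
           (p + (q + q) + (3 + (h + h)) ≡ j ⊎ p + (q + q) + (3 + (h + h)) ≡ j + (3 + k)) → HasParity p′ z
    go (j , j≤ , t , e) =
      let q′ , e′ = extension-parity p′ (p + q + 1 + h) (p + (q + q)) (3 + (h + h)) j
                      (subst (p′ ≤_) pp (m≤n+m p′ p)) total e
      in has-parity p′ q′ j e′ j≤
        (exit (join (point {S = _≡ z} refl) f (point {S = _≡ w} refl) λ { refl z≡w → z≢w z≡w })
          (λ { (inj₁ refl) → z-out ; (inj₂ refl) → w-out }) f′ t ≤-refl (sym k≡))

  has-parity-from-op : ∀ p p′ → p + p′ ≡ 1 → Op.HasParity p′ z → HasParity p z
  has-parity-from-op p p′ pp (q , q≤ , t) with opposite-half p′ q q≤
  ... | q′ , e = q′ , opposite-index≤ p′ p q q′ p′p e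
      , touches-op (p′ + (q + q)) (p + (q′ + q′)) (trans (+-comm (p′ + (q + q)) _) (opposite-index p′ p q q′ p′p e)) t
    where
    p′p : p′ + p ≡ 1
    p′p = trans (+-comm p′ p) pp

-- Attachment to the path, and silent or deaf pairs

module Attachment {n k} (h : ℕ) (k≡ : k ≡ 5 + (h + h)) {D : Digraph (Fin n)} (G : Geodesic D k)
                  (connected : ∀ a b → ∃[ ℓ ] Walk D a b ℓ) where

  open Distances h k≡ G connected public

  opposite-connected : ∀ a b → ∃[ ℓ ] Walk (opposite D) a b ℓ
  opposite-connected a b with connected b a
  ... | ℓ , w = ℓ , reverse-walk w

  private
    module Op = Distances h k≡ (opposite-geodesic G) opposite-connected
    variable
      z w : Fin n

  two-step-op : ∀ p p′ q → p + p′ ≡ 1 → Out z → Out w → z ≢ w → Arc D w z → p + (q + q) ≤ 2 + k →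
                Arc D (x (p + (q + q))) w → HasParity p′ z
  two-step-op p p′ q pp z-out w-out z≢w f q≤ f′ with opposite-half p q q≤
  ... | q′ , e = has-parity-from-op p′ p p′p
    (Op.two-step p′ p q′ p′p (out-op z-out) (out-op w-out) z≢w f (opposite-index≤ p p′ q q′ pp e)
      (arc-from-op (p′ + (q′ + q′)) (p + (q + q)) (opposite-index p p′ q q′ pp e) f′))
    where
    p′p : p′ + p ≡ 1
    p′p = trans (+-comm p′ p) pp

  arc⇒≢ : Arc D z w → z ≢ w
  arc⇒≢ f refl = loopless D _ f

  arc-from? : ∀ z → HasArcFrom z ⊎ Deaf z
  arc-from? z with anyUpTo? (λ i → arc? D (x i) z) (3 + k)
  ... | yes (i , i< , f) = inj₁ (i , ≤-pred i< , f)
  ... | no none          = inj₂ λ j j≤ f → none (j , s≤s j≤ , f)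

  entered : Out z → Out w → Arc D w z → HasArcFrom w → Attached z
  entered {z} {w} z-out w-out f (i , i≤ , g) with parity i
  ... | 0 , q , _ , refl = inj₂ (two-step-op 0 1 q refl z-out w-out (λ z≡w → arc⇒≢ f (sym z≡w)) f i≤ g)
  ... | 1 , q , _ , refl = inj₁ (two-step-op 1 0 q refl z-out w-out (λ z≡w → arc⇒≢ f (sym z≡w)) f i≤ g)
  ... | suc (suc _) , _ , s≤s () , _

  -- At distance above k, the vertex w at distance k from z along a shortest exit
  -- sends an arc back to z.  The vertex before w sends no arc to the path, so w receives one from it,
  -- which is then prolonged to z.
  attached-at : ∀ b m → m ≤ b → ∀ z → Dist (suc m) z → Attached z
  attached-at b m m≤b z d = case (≤-<-connex (suc m) k)
    where
    near : ∃[ L ] suc m + L ≡ k → Attached z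
    near (L , e) =
      let y , d₁ , t      = approach m 1 (subst (λ m → Dist m z) (+-comm 1 m) d)
          i , i≤ , f      = dist-1 d₁
          j , j≤ , t′ , _ = extend i L i≤ L≤
      in some-parity j≤ (exit t (approach-out (dist-out d)) f t′ ≤-refl (trans (+-suc m L) e))
      where
      L≤ : L ≤ 4 + (h + h)
      L≤ = lin (≤-reflexive e ⊹ ≤-reflexive k≡) m (solve (L ∷ˡ h ∷ˡ k ∷ˡ m ∷ˡ []ˡ))
    far : ∀ b → m ≤ b → ∃[ r ] k + r ≡ m → Attached z
    far zero    m≤0 (r , e) = lin-⊥ (m≤0 ⊹ ≤-reflexive e ⊹ ≤-reflexive (sym k≡)) (4 + r + h + h)
        (solve (h ∷ˡ k ∷ˡ m ∷ˡ r ∷ˡ []ˡ))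
    far (suc b) m≤b (r , e) =
      let y , d₂ , t = approach (4 + (h + h)) (2 + r) (subst (λ m → Dist m z) length d)
          w , f , d₁ = nearer d₂
      in far-case d₂ d₁ f (last-arc d₁ f t)
      where
      length : suc m ≡ 4 + (h + h) + (2 + r)
      length = lin-≡ (sym e ⊞ k≡) (solve (h ∷ˡ k ∷ˡ m ∷ˡ r ∷ˡ []ˡ))
      4+2h+1≡k : 4 + (h + h) + 1 ≡ k
      4+2h+1≡k = lin-≡ (sym k≡) (solve (h ∷ˡ k ∷ˡ []ˡ))
      2+r≤ : 3 + r ≤ m
      2+r≤ = lin (≤-reflexive e ⊹ ≤-reflexive (sym k≡)) (2 + h + h) (solve (h ∷ˡ k ∷ˡ m ∷ˡ r ∷ˡ []ˡ))
      1+r≤b : 1 + r ≤ b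
      1+r≤b = lin (2+r≤ ⊹ m≤b) 1 (solve (b ∷ˡ m ∷ˡ r ∷ˡ []ˡ))
      beyond : ∀ {c} → Reach c z → c ≤ m → ⊥
      beyond r c≤m = 1+n≰n (≤-trans (dist≤ d r) c≤m)
      last-arc : ∀ {y w} → Dist (1 + r) w → Arc D y w →
                 Trail D (Approach z (2 + r) (4 + (h + h) + (2 + r))) z y (4 + (h + h)) → Adjacent D z w
      last-arc {w = w} d₁ f t = quasi-trail (join t f (point {S = _≡ w} refl)
        λ { (inj₁ refl) refl → beyond (proj₁ d₁) (≤-trans (s≤s (m≤n+m r 2)) 2+r≤)
          ; (inj₂ (c , r≤ , _ , dc)) refl → 1+n≰n (≤-trans r≤ (dist≤ dc (proj₁ d₁))) })
        4+2h+1≡k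
      far-case : ∀ {y w} → Dist (2 + r) y → Dist (1 + r) w → Arc D y w → Adjacent D z w → Attached z
      far-case {y} {w} d₂ d₁ f (inj₁ g) = ⊥-elim (beyond {2 + r} (w , g , proj₁ d₁) (≤-trans (n≤1+n _) 2+r≤))
      far-case {y} {w} d₂ d₁ f (inj₂ g) = [ entered (dist-out d) (dist-out d₁) g , (λ deaf → ⊥-elim
        (silent↛deaf (dist-out d₂) (dist-out d₁) (attached-at b (1 + r) 1+r≤b y d₂)
          (attached-at b r (≤-trans (n≤1+n r) 1+r≤b) w d₁) (dist-silent d₂) deaf f)) ]′ (arc-from? w)
    case : suc m ≤ k ⊎ k < suc m → Attached z
    case (inj₁ m<k) = near (≤⇒∃ m<k)
    case (inj₂ k≤m) = far b m≤b (≤⇒∃ (≤-pred k≤m))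

  attached : Out z → Attached z
  attached {z} out = let m , d = distance z out in attached-at m m ≤-refl z d

  Mixed : Fin n → Set
  Mixed z = HasParity 0 z × HasParity 1 z

  through : ∀ i j → i + (3 + (h + h)) ≡ j → j ≤ 2 + k → Out z → Out w → Arc D (x j) z → Arc D z w → Touches w i
  through {z} {w} i j e j≤ z-out w-out g f = swap (quasi-trail
    (join (run i (3 + (h + h)) j e j≤) g
      (join (point {S = _≡ z} refl) f (point {S = _≡ w} refl) λ { refl z≡w → arc⇒≢ f z≡w })
      λ { (m , m<j , eq) (inj₁ refl) → z-out (m , ≤-trans m<j (s≤s j≤) , eq)
        ; (m , m<j , eq) (inj₂ refl) → w-out (m , ≤-trans m<j (s≤s j≤) , eq) })
    (lin-≡ (sym k≡) (solve (h ∷ˡ k ∷ˡ []ˡ))))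

  -- By `full-in` every path vertex sends an arc to z, so x_0 ... x_{k-2}, z, w and x_1 ... x_{k-1},
  -- z, w are paths of k arcs.
  mixed-successor : Out z → Out w → Mixed z → Silent z → Arc D z w → Mixed w
  mixed-successor z-out w-out (even , odd) silent f =
      has-parity 0 0 0 refl z≤n (through 0 (3 + (h + h)) refl 3+2h≤ z-out w-out
        (arc-at 3+2h (full-in 1 0 (1 + h) refl z-out odd silent (subst (_≤ 2 + k) (sym 3+2h) 3+2h≤))) f)
    , has-parity 1 0 1 refl (s≤s z≤n) (through 1 (4 + (h + h)) refl 4+2h≤ z-out w-out
        (arc-at 4+2h (full-in 0 1 (2 + h) refl z-out even silent (subst (_≤ 2 + k) (sym 4+2h) 4+2h≤))) f)
    where
    3+2h : 1 + ((1 + h) + (1 + h)) ≡ 3 + (h + h)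
    3+2h = solve (h ∷ˡ []ˡ)
    3+2h≤ : 3 + (h + h) ≤ 2 + k
    3+2h≤ = lin (≤-reflexive (sym k≡)) 4 (solve (h ∷ˡ k ∷ˡ []ˡ))
    4+2h : (2 + h) + (2 + h) ≡ 4 + (h + h)
    4+2h = solve (h ∷ˡ []ˡ)
    4+2h≤ : 4 + (h + h) ≤ 2 + k
    4+2h≤ = lin (≤-reflexive (sym k≡)) 3 (solve (h ∷ˡ k ∷ˡ []ˡ))

  -- `bridge` needs arcs in both directions between z and the path. A silent z hands both parities
  -- to the next vertex of a shortest exit, which is not deaf by `silent↛deaf`; the last vertex of
  -- the exit also has an arc to the path.
  find-bridge : ∀ m z → Dist (suc m) z → Mixed z → HasArcFrom z → ∃[ y ] Out y × Mixed y × Bridge y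
  find-bridge zero    z d (even , odd) from =
    z , dist-out d , (even , odd) , bridge (dist-out d) even odd from (dist-1 d)
  find-bridge (suc m) z d mixed        from with nearer d
  ... | y , f , d′ with arc-from? y
  ...   | inj₁ from-y = find-bridge m y d′ (mixed-successor (dist-out d) (dist-out d′) mixed (dist-silent d) f) from-y
  ...   | inj₂ deaf   = ⊥-elim (silent↛deaf (dist-out d) (dist-out d′)
                          (inj₁ (proj₁ mixed)) (attached (dist-out d′)) (dist-silent d) deaf f)

  -- Passed as an argument until `world` establishes it, because that proof also uses bridges found
  -- in the reversed digraph.
  World : Set
  World = (∀ z → Out z → Mixed z) ⊎ (∀ z → Out z → ¬ Mixed z)

  no-arcs-to : NoArcTo 0 z → NoArcTo 1 z → Silent z
  no-arcs-to s₀ s₁ j j≤ f with parity j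
  ... | 0 , q , _ , e = s₀ q j e j≤ f
  ... | 1 , q , _ , e = s₁ q j e j≤ f
  ... | suc (suc _) , _ , s≤s () , _

  no-arcs-from : NoArcFrom 0 z → NoArcFrom 1 z → Deaf z
  no-arcs-from s₀ s₁ j j≤ f with parity j
  ... | 0 , q , _ , e = s₀ q j e j≤ f
  ... | 1 , q , _ , e = s₁ q j e j≤ f
  ... | suc (suc _) , _ , s≤s () , _

  in-low-out-high : ∀ i j → i ≤ 1 → 1 + k ≤ j → j ≤ 2 + k → Arc D (x i) z → Arc D z (x j) → ⊥
  in-low-out-high i j i≤1 k<j j≤ g f =
    (lin-⊥ ((via i j (≤-trans i≤1 (s≤s z≤n)) j≤ g f) ⊹ i≤1 ⊹ k<j ⊹ ≤-reflexive (sym k≡)) (2 + h + h)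
        (solve (h ∷ˡ i ∷ˡ j ∷ˡ k ∷ˡ []ˡ)))

  private
    1+k≡ : (3 + h) + (3 + h) ≡ 1 + k
    1+k≡ = lin-≡ (sym k≡) (solve (h ∷ˡ k ∷ˡ []ˡ))

  no-even-to-no-odd-from : Out z → Mixed z → NoArcTo 0 z → ¬ NoArcFrom 1 z
  no-even-to-no-odd-from {z} out (even , odd) s₀ d₁ with corners-even out even | corners-odd out odd
  ... | inj₁ f , _ | _                    = s₀ 0 0 refl z≤n f
  ... | inj₂ g , _ | _ , _ , _ , inj₂ g′ = d₁ (3 + h) (2 + k) (cong suc 1+k≡) ≤-refl g′
  ... | inj₂ g , _ | _ , _ , _ , inj₁ f  = in-low-out-high 0 (2 + k) z≤n (n≤1+n _) ≤-refl g f

  no-odd-to-no-even-from : Out z → Mixed z → NoArcTo 1 z → ¬ NoArcFrom 0 z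
  no-odd-to-no-even-from {z} out (even , odd) s₁ d₀ with corners-even out even | corners-odd out odd
  ... | _                   | inj₁ f , _ = s₁ 0 1 refl (s≤s z≤n) f
  ... | _ , _ , _ , inj₂ g′ | inj₂ g , _ = d₀ (3 + h) (1 + k) 1+k≡ (n≤1+n _) g′
  ... | _ , _ , _ , inj₁ f  | inj₂ g , _ = in-low-out-high 1 (1 + k) ≤-refl ≤-refl (n≤1+n _) g f

  -- If all vertices have both parities, `nonadjacent` applies also with z and w exchanged, and the
  -- corners exclude conflicting outcomes. If none has, an arc at the other parity would create such
  -- a vertex.
  extremal-even-odd : World → Out z → Out w → z ≢ w → ¬ Adjacent D z w → HasParity 0 z → HasParity 1 w →
                      (Silent z × Silent w) ⊎ (Deaf z × Deaf w)
  extremal-even-odd (inj₁ mixed) z-out w-out z≢w ¬zw even odd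
    with nonadjacent z-out w-out z≢w ¬zw even odd
       | nonadjacent w-out z-out (λ w≡z → z≢w (sym w≡z)) (λ wz → ¬zw (swap wz))
           (proj₁ (mixed _ w-out)) (proj₂ (mixed _ z-out))
  ... | inj₁ (z₀ , w₁) | inj₁ (w₀ , z₁) = inj₁ (no-arcs-to z₀ z₁ , no-arcs-to w₀ w₁)
  ... | inj₂ (z₀ , w₁) | inj₂ (w₀ , z₁) = inj₂ (no-arcs-from z₀ z₁ , no-arcs-from w₀ w₁)
  ... | inj₁ (z₀ , w₁) | inj₂ (w₀ , z₁) = ⊥-elim (no-even-to-no-odd-from z-out (mixed _ z-out) z₀ z₁)
  ... | inj₂ (z₀ , w₁) | inj₁ (w₀ , z₁) = ⊥-elim (no-odd-to-no-even-from z-out (mixed _ z-out) z₁ z₀)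
  extremal-even-odd (inj₂ unmixed) z-out w-out z≢w ¬zw even odd
    with nonadjacent z-out w-out z≢w ¬zw even odd
  ... | inj₁ (z₀ , w₁) = inj₁
    ( no-arcs-to z₀ (λ q j e j≤ f → unmixed _ z-out (even , has-parity 1 q j e j≤ (inj₁ f)))
    , no-arcs-to (λ q j e j≤ f → unmixed _ w-out (has-parity 0 q j e j≤ (inj₁ f) , odd)) w₁)
  ... | inj₂ (z₀ , w₁) = inj₂
    ( no-arcs-from z₀ (λ q j e j≤ f → unmixed _ z-out (even , has-parity 1 q j e j≤ (inj₂ f)))
    , no-arcs-from (λ q j e j≤ f → unmixed _ w-out (has-parity 0 q j e j≤ (inj₂ f) , odd)) w₁)

  extremal : World → ∀ p p′ → p + p′ ≡ 1 → Out z → Out w → z ≢ w → ¬ Adjacent D z w →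
             HasParity p z → HasParity p′ w → (Silent z × Silent w) ⊎ (Deaf z × Deaf w)
  extremal world 0 .1 refl z-out w-out z≢w ¬zw r s = extremal-even-odd world z-out w-out z≢w ¬zw r s
  extremal world 1 0  pp   z-out w-out z≢w ¬zw r s
    with extremal-even-odd world w-out z-out (λ w≡z → z≢w (sym w≡z)) (λ wz → ¬zw (swap wz)) s r
  ... | inj₁ (w-silent , z-silent) = inj₁ (z-silent , w-silent)
  ... | inj₂ (w-deaf , z-deaf)     = inj₂ (z-deaf , w-deaf)

  silent⇒¬deaf : Attached z → Silent z → ¬ Deaf z
  silent⇒¬deaf (inj₁ (q , q≤ , inj₁ f)) silent deaf = silent _ q≤ f
  silent⇒¬deaf (inj₁ (q , q≤ , inj₂ g)) silent deaf = deaf _ q≤ g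
  silent⇒¬deaf (inj₂ (q , q≤ , inj₁ f)) silent deaf = silent _ q≤ f
  silent⇒¬deaf (inj₂ (q , q≤ , inj₂ g)) silent deaf = deaf _ q≤ g

  adjacent? : ∀ z w → Dec (Adjacent D z w)
  adjacent? z w = arc? D z w ⊎-dec arc? D w z

  -- If no vertex has both parities, j + 1 has the parity of z, hence j that of w. This allows the
  -- last step to x_{j+1} to be replaced by an arc from x_j to w.
  predecessor-parity : World → ∀ p p′ → p + p′ ≡ 1 → Out z → Out w → HasParity p z → HasParity p′ w →
                       ∀ j → suc j ≤ 2 + k → Touches z (suc j) →
                       ∃[ r ] ∃[ r′ ] ∃[ s ] r + r′ ≡ 1 × r + (s + s) ≡ j × HasParity r w
  predecessor-parity (inj₁ mixed) p p′ pp z-out w-out r s j j< t with parity j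
  ... | 0 , q , _ , e = 0 , 1 , q , refl , e , proj₁ (mixed _ w-out)
  ... | 1 , q , _ , e = 1 , 0 , q , refl , e , proj₂ (mixed _ w-out)
  ... | suc (suc _) , _ , s≤s () , _
  predecessor-parity (inj₂ unmixed) p p′ pp z-out w-out r s j j< t with parity j
  predecessor-parity (inj₂ unmixed) 0 .1 refl z-out w-out r s j j< t | 0 , q , _ , e =
    ⊥-elim (unmixed _ z-out (r , has-parity 1 q (suc j) (cong suc e) j< t))
  predecessor-parity (inj₂ unmixed) 1 0 _ z-out w-out r s j j< t | 0 , q , _ , e = 0 , 1 , q , refl , e , s
  predecessor-parity (inj₂ unmixed) 0 .1 refl z-out w-out r s j j< t | 1 , q , _ , e = 1 , 0 , q , refl , e , s
  predecessor-parity (inj₂ unmixed) 1 0 _ z-out w-out r s j j< t | 1 , q , _ , e =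
    ⊥-elim (unmixed _ z-out (has-parity 0 (suc q) (suc j) (cong suc (trans (+-suc q q) e)) j< t , r))
  predecessor-parity (inj₂ unmixed) p p′ pp z-out w-out r s j j< t | suc (suc _) , _ , s≤s () , _

  -- An exit from z of length below k is prolonged along the path and ends with an arc into w; on a
  -- longer exit, the vertex at distance k - 1 from z has the parity of z and is closer to the path.
  silent-adjacent : World → ∀ b m → m ≤ b → ∀ p p′ → p + p′ ≡ 1 → ∀ z w → Dist (suc m) z → Out w →
                    (∀ r → Reach r w → m < r) → z ≢ w → Silent z → Silent w →
                    HasParity p z → HasParity p′ w → Adjacent D z w
  silent-adjacent world b m m≤b p p′ pp z w d w-out w-far z≢w z-silent w-silent z-par w-par =
    case (≤-<-connex (suc m) (4 + (h + h)))
    where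
    z-out : Out z
    z-out = dist-out d
    p≤ : p + 0 ≤ 2 + k
    p≤ = lin (≤-reflexive pp) (1 + k + p′) (solve (k ∷ˡ p ∷ˡ p′ ∷ˡ []ˡ))
    p→z : Arc D (x (p + 0)) z
    p→z = full-in p p′ 0 pp z-out z-par z-silent p≤
    w-off : ∀ {r} → ¬ Approach z (suc r) (suc m) w
    w-off (inj₁ w≡z)                  = z≢w (sym w≡z)
    w-off (inj₂ (c , _ , c≤m , dc)) = 1+n≰n (≤-trans (w-far c (proj₁ dc)) (≤-pred c≤m))
    near : ∃[ L ] suc m + L ≡ 4 + (h + h) → Adjacent D z w
    near (L , e) =
      let y , d₁ , t = approach m 1 (subst (λ m → Dist m z) (+-comm 1 m) d)
          i , i≤ , f = dist-1 d₁
      in along y i t f i≤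
      where
      along : ∀ y i → Trail D (Approach z 1 (m + 1)) z y m → Arc D y (x i) → i ≤ 2 + k → Adjacent D z w
      along y i t f i≤ =
        let r , r′ , s , rr , e′ , w-r = predecessor-parity world p p′ pp z-out w-out z-par w-par (i + L) 1+j≤
              (exit t (approach-out z-out) f (run i (suc L) (suc (i + L)) (+-suc i L) 1+j≤) (s≤s 1+j≤) length)
        in exit-to t (approach-out z-out) (subst (λ hi → ¬ Approach z 1 hi w) (+-comm 1 m) w-off) w-out f
             (run i L (i + L) refl j≤) (s≤s j≤)
             (subst (λ j → Arc D (x j) w) e′ (full-in r r′ s rr w-out w-r w-silent (subst (_≤ 2 + k) (sym e′) j≤)))
             (trans (+-comm _ 1) (trans (sym (+-suc m (suc L))) length))
        where
        -- The arc x_p → z, the exit to y and y → x_i form a walk between path vertices. It keeps i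
        -- so small that the k-arc path does not run beyond x_N.
        i-bound : i ≤ p + 0 + suc (m + 1)
        i-bound = short (p + 0) i p≤ i≤ (p→z ∷ join-walk (Trail.walk t) f [ x i ])
        1+j≤ : suc (i + L) ≤ 2 + k
        1+j≤ = lin (i-bound ⊹ ≤-reflexive e ⊹ ≤-reflexive pp ⊹ ≤-reflexive (sym k≡)) p′
            (solve (L ∷ˡ h ∷ˡ i ∷ˡ k ∷ˡ m ∷ˡ p ∷ˡ p′ ∷ˡ []ˡ))
        j≤ : i + L ≤ 2 + k
        j≤ = ≤-trans (n≤1+n _) 1+j≤
        length : m + suc (suc L) ≡ k
        length = lin-≡ (e ⊞ sym k≡) (solve (L ∷ˡ h ∷ˡ k ∷ˡ m ∷ˡ []ˡ))
    far : ∀ b → m ≤ b → ∃[ r ] 4 + (h + h) + r ≡ m → Adjacent D z w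
    far zero    m≤0 (r , e) = lin-⊥ (m≤0 ⊹ ≤-reflexive e) (3 + h + h + r) (solve (h ∷ˡ m ∷ˡ r ∷ˡ []ˡ))
    far (suc b) m≤b (r , e) =
      let y , d′ , t = approach (4 + (h + h)) (suc r) (subst (λ m → Dist m z) length d)
      in beside y d′ (subst (λ hi → Trail D (Approach z (suc r) hi) z y (4 + (h + h))) (sym length) t)
      where
      length : suc m ≡ 4 + (h + h) + suc r
      length = lin-≡ (sym e) (solve (h ∷ˡ m ∷ˡ r ∷ˡ []ˡ))
      4+2h+1≡k : 4 + (h + h) + 1 ≡ k
      4+2h+1≡k = lin-≡ (sym k≡) (solve (h ∷ˡ k ∷ˡ []ˡ))
      2+r≤m : 2 + r ≤ m
      2+r≤m = lin (≤-reflexive e) (2 + h + h) (solve (h ∷ˡ m ∷ˡ r ∷ˡ []ˡ))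
      r≤b : r ≤ b
      r≤b = ≤-pred (≤-trans (≤-trans (n≤1+n (suc r)) 2+r≤m) m≤b)
      w-far′ : ∀ c → Reach c w → r < c
      w-far′ c rc = ≤-trans (s≤s (≤-trans (m≤n+m r 2) 2+r≤m)) (w-far c rc)
      beside : ∀ y → Dist (suc r) y → Trail D (Approach z (suc r) (suc m)) z y (4 + (h + h)) → Adjacent D z w
      beside y d′ t = decide (adjacent? y w)
        where
        y-out : Out y
        y-out = dist-out d′
        y≢w : y ≢ w
        y≢w refl = 1+n≰n (≤-trans (≤-trans 2+r≤m (≤-pred (w-far (suc r) (proj₁ d′)))) (n≤1+n r))
        y-par : HasParity p y
        y-par = has-parity p 0 (p + 0) refl p≤ (swap (quasi-trail
          (join (point {S = _≡ x (p + 0)} refl) p→z t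
            λ { refl s → approach-out z-out s (p + 0 , s≤s p≤ , refl) })
          (sym k≡)))
        settle : ¬ Adjacent D y w → (Silent y × Silent w) ⊎ (Deaf y × Deaf w) → Adjacent D z w
        settle ¬yw (inj₁ (y-silent , _)) = ⊥-elim (¬yw
          (silent-adjacent world b r r≤b p p′ pp y w d′ w-out w-far′ y≢w y-silent w-silent y-par w-par))
        settle ¬yw (inj₂ (_ , w-deaf))   = ⊥-elim (silent⇒¬deaf (attached w-out) w-silent w-deaf)
        decide : Dec (Adjacent D y w) → Adjacent D z w
        decide (yes (inj₁ f)) = quasi-trail (join t f (point {S = _≡ w} refl) λ { s refl → w-off s }) 4+2h+1≡k
        -- The arc w → y would bring w within distance r + 2 ≤ m of the path.
        decide (yes (inj₂ g)) = ⊥-elim (1+n≰n (≤-trans (w-far (2 + r) (y , g , proj₁ d′)) 2+r≤m))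
        decide (no ¬yw)       = settle ¬yw (extremal world p p′ pp y-out w-out y≢w ¬yw y-par w-par)
    case : suc m ≤ 4 + (h + h) ⊎ 4 + (h + h) < suc m → Adjacent D z w
    case (inj₁ m<) = near (≤⇒∃ m<)
    case (inj₂ <m) = far b m≤b (≤⇒∃ (≤-pred <m))

  silent-pair : World → ∀ p p′ → p + p′ ≡ 1 → Out z → Out w → z ≢ w → Silent z → Silent w →
                HasParity p z → HasParity p′ w → Adjacent D z w
  silent-pair {z} {w} world p p′ pp z-out w-out z≢w z-silent w-silent z-par w-par =
    let m₁ , d₁ = distance z z-out
        m₂ , d₂ = distance w w-out
    in compare m₁ d₁ m₂ d₂ (≤-total m₁ m₂)
    where
    compare : ∀ m₁ → Dist (suc m₁) z → ∀ m₂ → Dist (suc m₂) w → m₁ ≤ m₂ ⊎ m₂ ≤ m₁ → Adjacent D z w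
    compare m₁ d₁ m₂ d₂ (inj₁ m₁≤m₂) = silent-adjacent world m₁ m₁ ≤-refl p p′ pp z w d₁ w-out
      (λ r reach → ≤-trans (s≤s m₁≤m₂) (dist≤ d₂ reach)) z≢w z-silent w-silent z-par w-par
    compare m₁ d₁ m₂ d₂ (inj₂ m₂≤m₁) = swap (silent-adjacent world m₂ m₂ ≤-refl p′ p (trans (+-comm p′ p) pp) w z d₂ z-out
      (λ r reach → ≤-trans (s≤s m₂≤m₁) (dist≤ d₁ reach)) (λ w≡z → z≢w (sym w≡z)) w-silent z-silent w-par z-par)

-- The dichotomy

module Structure {n k} (h : ℕ) (k≡ : k ≡ 5 + (h + h)) {D : Digraph (Fin n)} (G : Geodesic D k)
                 (connected : ∀ a b → ∃[ ℓ ] Walk D a b ℓ) where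

  open Attachment h k≡ G connected public

  private
    module Op = Attachment h k≡ (opposite-geodesic G) opposite-connected
    variable
      z w : Fin n

  out-from-op : Op.Out z → Out z
  out-from-op out (m , m< , eq) =
    out (2 + k ∸ m , s≤s (m∸n≤m (2 + k) m) , trans eq (sym (mirror G (2 + k ∸ m) m (m∸n+n≡m (≤-pred m<)))))

  has-parity? : ∀ p z → Dec (HasParity p z)
  has-parity? p z with anyUpTo? (λ q → (p + (q + q) ≤? 2 + k) ×-dec adjacent? z (x (p + (q + q)))) (3 + k)
  ... | yes (q , _ , r) = yes (q , r)
  ... | no none         = no λ { (q , q≤ , t) →
    none (q , s≤s (≤-trans (≤-trans (m≤m+n q q) (m≤n+m (q + q) p)) q≤) , q≤ , t) }

  -- A deaf z has an arc to the path, which reversal turns into the arc from the path that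
  -- `find-bridge` requires.
  some-bridge : Out z → Mixed z → ∃[ y ] Out y × Mixed y × Bridge y
  some-bridge {z} out mixed with arc-from? z
  ... | inj₁ from = let m , d = distance z out in find-bridge m z d mixed from
  ... | inj₂ deaf =
    let m , d = Op.distance z (out-op out)
        y , y-out , (even , odd) , br = Op.find-bridge m z d
          (has-parity-op 1 0 refl (proj₂ mixed) , has-parity-op 0 1 refl (proj₁ mixed))
          (has-arc-to-op (arc-to (proj₁ mixed)))
    in y , out-from-op y-out , (has-parity-from-op 0 1 refl odd , has-parity-from-op 1 0 refl even) , bridge-from-op br
    where
    arc-to : HasParity 0 z → HasArcTo z
    arc-to (q , q≤ , inj₁ f) = q + q , q≤ , f
    arc-to (q , q≤ , inj₂ g) = ⊥-elim (deaf (q + q) q≤ g)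

  all-mixed : Out z → Mixed z → ∀ w → Out w → Mixed w
  all-mixed out mixed w w-out with some-bridge out mixed
  ... | y , y-out , y-mixed , br with y Fin.≟ w
  ...   | yes refl = y-mixed
  ...   | no y≢w with attached w-out
  ...     | inj₁ even = even , spread 0 1 refl y-out w-out y≢w br even
  ...     | inj₂ odd  = spread 1 0 refl y-out w-out y≢w br odd , odd

  world : World
  world with Fin.any? (λ z → ¬? (below? z) ×-dec (has-parity? 0 z ×-dec has-parity? 1 z))
  ... | yes (z , out , mixed) = inj₁ (all-mixed out mixed)
  ... | no none               = inj₂ λ z out mixed → none (z , out , mixed)

  world-op : World → Op.World
  world-op (inj₁ mixed) = inj₁ λ z out → let even , odd = mixed z (out-from-op out) in
    has-parity-op 1 0 refl odd , has-parity-op 0 1 refl even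
  world-op (inj₂ unmixed) = inj₂ λ { z out (even , odd) →
    unmixed z (out-from-op out) (has-parity-from-op 0 1 refl odd , has-parity-from-op 1 0 refl even) }

  -- A nonadjacent pair would consist of two silent or two deaf vertices, and the deaf case is the
  -- silent one reversed.
  opposite-adjacent : ∀ p p′ → p + p′ ≡ 1 → Out z → Out w → z ≢ w → HasParity p z → HasParity p′ w → Adjacent D z w
  opposite-adjacent {z} {w} p p′ pp z-out w-out z≢w r s with adjacent? z w
  ... | yes zw = zw
  ... | no ¬zw with extremal world p p′ pp z-out w-out z≢w ¬zw r s
  ...   | inj₁ (z-silent , w-silent) = silent-pair world p p′ pp z-out w-out z≢w z-silent w-silent r s
  ...   | inj₂ (z-deaf , w-deaf) = swap (Op.silent-pair (world-op world) p′ p p′p (out-op z-out) (out-op w-out) z≢w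
            (λ j _ → z-deaf (2 + k ∸ j) (m∸n≤m (2 + k) j)) (λ j _ → w-deaf (2 + k ∸ j) (m∸n≤m (2 + k) j))
            (has-parity-op p p′ pp r) (has-parity-op p′ p p′p s))
    where
    p′p : p′ + p ≡ 1
    p′p = trans (+-comm p′ p) pp

  -- Independence of the two parity classes

  module Unmixed (unmixed : ∀ z → Out z → ¬ Mixed z) where

    exclusive : ∀ p p′ → p + p′ ≡ 1 → Out z → HasParity p z → ¬ HasParity p′ z
    exclusive 0 .1 refl out r s = unmixed _ out (r , s)
    exclusive 1 0  _    out r s = unmixed _ out (s , r)

    parity-unique : ∀ p p′ r → p + p′ ≡ 1 → r ≤ 1 → Out z → HasParity p z → HasParity r z → r ≡ p
    parity-unique 0 .1 0 refl _ out _ _ = refl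
    parity-unique 0 .1 1 refl _ out s t = ⊥-elim (unmixed _ out (s , t))
    parity-unique 1 0  0 _    _ out s t = ⊥-elim (unmixed _ out (t , s))
    parity-unique 1 0  1 _    _ out _ _ = refl
    parity-unique _ _ (suc (suc _)) _ (s≤s ()) _ _ _

    -- The arc from w to the path would end at parity p, and `two-step` would give z the other
    -- parity. With the dual lemma, an arc inside a class can only run from a deaf vertex to a
    -- silent one.
    no-arc-to : ∀ p p′ → p + p′ ≡ 1 → Out z → Out w → Arc D z w → HasParity p z → HasParity p w → ¬ HasArcTo w
    no-arc-to p p′ pp z-out w-out f z-par w-par (i , i≤ , g) with parity i
    ... | r , q , r≤1 , refl with parity-unique p p′ r pp r≤1 w-out w-par (has-parity r q _ refl i≤ (inj₁ g))
    ...   | refl = exclusive p p′ pp z-out z-par (two-step p p′ q pp z-out w-out (arc⇒≢ f) f i≤ g)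

    no-arc-from : ∀ p p′ → p + p′ ≡ 1 → Out z → Out w → Arc D z w → HasParity p z → HasParity p w → ¬ HasArcFrom z
    no-arc-from p p′ pp z-out w-out f z-par w-par (i , i≤ , g) with parity i
    ... | r , q , r≤1 , refl with parity-unique p p′ r pp r≤1 z-out z-par (has-parity r q _ refl i≤ (inj₂ g))
    ...   | refl = exclusive p p′ pp w-out w-par
                     (two-step-op p p′ q pp w-out z-out (λ w≡z → arc⇒≢ f (sym w≡z)) f i≤ g)

    Beside : Fin n → Fin n → Set
    Beside z v = Out v × v ≢ z

    -- z will be put in front of this exit, so the exit must miss it. As z is at distance 1, it
    -- could only be the last vertex y; but the vertex before y is silent and sends no arc to a deaf
    -- vertex.
    avoiding-exit : ∀ c r → Dist (c + (2 + r)) w → Out z → Reach 1 z → Deaf z → z ≢ w →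
                    ∃[ y ] Dist (1 + r) y × Trail D (Beside z) w y (c + 1) × ¬ Deaf y
    avoiding-exit {w} {z} c r d z-out z-reach z-deaf z≢w =
      let y₂ , d₂ , t = approach c (2 + r) d
          y  , e , d₁ = nearer d₂
      in finish y₂ y d₂ t e d₁
      where
      w-out : Out w
      w-out = dist-out (subst (λ m → Dist m w) (+-suc c (suc r)) d)
      finish : ∀ y₂ y → Dist (2 + r) y₂ → Trail D (Approach w (2 + r) (c + (2 + r))) w y₂ c → Arc D y₂ y →
               Dist (1 + r) y → ∃[ y ] Dist (1 + r) y × Trail D (Beside z) w y (c + 1) × ¬ Deaf y
      finish y₂ y d₂ t e d₁ = y , d₁ , widen beside (join t e (point {S = _≡ y} refl) off) , ¬deaf
        where
        ¬deaf : ¬ Deaf y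
        ¬deaf deaf = silent↛deaf (dist-out d₂) (dist-out d₁) (attached (dist-out d₂)) (attached (dist-out d₁))
          (dist-silent d₂) deaf e
        off : ∀ {v} → Approach w (2 + r) (c + (2 + r)) v → ¬ v ≡ y
        off (inj₁ refl)                  refl = 1+n≰n (≤-trans (m≤n+m (2 + r) c) (dist≤ d (proj₁ d₁)))
        off (inj₂ (_ , r≤ , _ , dv)) refl = 1+n≰n (≤-trans r≤ (dist≤ dv (proj₁ d₁)))
        beside : ∀ {v} → Approach w (2 + r) (c + (2 + r)) v ⊎ v ≡ y → Beside z v
        beside (inj₂ refl) = dist-out d₁ , λ { refl → ¬deaf z-deaf }
        beside (inj₁ (inj₁ refl)) = w-out , λ w≡z → z≢w (sym w≡z)
        beside (inj₁ (inj₂ (_ , r≤ , _ , dv))) = approach-out w-out (inj₂ (_ , r≤ , ≤-refl , dv)) , λ { refl →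
          1+n≰n (≤-trans (s≤s (s≤s z≤n)) (≤-trans r≤ (dist≤ dv z-reach))) }

    -- An exit from w of length below k, prolonged along the path with and without z in front, gives z
    -- the parity opposite to that of w; on a longer exit, z can be paired with a closer vertex instead.
    deaf↛silent : ∀ p p′ → p + p′ ≡ 1 → ∀ b m → m ≤ b → ∀ z w → Dist (2 + m) w → Out z → Deaf z → Arc D z w →
                  HasParity p z → ¬ HasParity p w
    deaf↛silent p p′ pp b m m≤b z w d z-out z-deaf f z-par w-par = case (≤-<-connex (2 + m) (4 + (h + h)))
      where
      w-out : Out w
      w-out = dist-out d
      z-reach : HasParity p z → Reach 1 z
      z-reach (q , q≤ , inj₁ g) = x (p + (q + q)) , g , p + (q + q) , s≤s q≤ , refl
      z-reach (q , q≤ , inj₂ g) = ⊥-elim (z-deaf (p + (q + q)) q≤ g)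
      from-z : ∀ {y ℓ} → Trail D (Beside z) w y ℓ → Trail D (λ v → v ≡ z ⊎ Beside z v) z y (suc ℓ)
      from-z t = join (point {S = _≡ z} refl) f t λ { refl (_ , z≢z) → z≢z refl }
      near : ∃[ L ] 2 + m + L ≡ 4 + (h + h) → ⊥
      near (L , e) =
        let y , d₁ , t , _ = avoiding-exit m 0 (subst (λ m → Dist m w) (+-comm 2 m) d)
                               z-out (z-reach z-par) z-deaf (arc⇒≢ f)
            i , i≤ , g = dist-1 d₁
            j , j≤ , t₁ , i+L = extend i L i≤ L≤
            j′ , j′≤ , t₂ , i+1+L = extend i (suc L) i≤ 1+L≤
        in conclude i j j′ i+L i+1+L j≤ j′≤
             (exit (from-z t) (λ { (inj₁ refl) → z-out ; (inj₂ s) → proj₁ s }) g t₁ ≤-refl length₁)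
             (exit t proj₁ g t₂ ≤-refl length₂)
        where
        L≤ : L ≤ 4 + (h + h)
        L≤ = subst (L ≤_) e (m≤n+m L (2 + m))
        1+L≤ : suc L ≤ 4 + (h + h)
        1+L≤ = lin (≤-reflexive e) (1 + m) (solve (L ∷ˡ h ∷ˡ m ∷ˡ []ˡ))
        length₁ : suc (m + 1) + suc L ≡ k
        length₁ = lin-≡ (e ⊞ sym k≡) (solve (L ∷ˡ h ∷ˡ k ∷ˡ m ∷ˡ []ˡ))
        length₂ : m + 1 + suc (suc L) ≡ k
        length₂ = lin-≡ (e ⊞ sym k≡) (solve (L ∷ˡ h ∷ˡ k ∷ˡ m ∷ˡ []ˡ))
        same-parity : ∀ q i j → p + (q + q) ≡ j → i + suc L ≡ j ⊎ i + suc L ≡ j + (3 + k) →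
                      ∃[ Q ] p + (Q + Q) ≡ suc (i + L)
        same-parity q i j c (inj₁ c′) = q , trans c (trans (sym c′) (+-suc i L))
        -- The wrap subtracts k + 3, which is twice h + 4.
        same-parity q i j c (inj₂ c′) = q + (h + 4) ,
          (lin-≡ (c ⊞ sym c′ ⊞ sym k≡) (solve (L ∷ˡ h ∷ˡ i ∷ˡ j ∷ˡ k ∷ˡ p ∷ˡ q ∷ˡ []ˡ)))
        conclude : ∀ i j j′ → i + L ≡ j ⊎ i + L ≡ j + (3 + k) → i + suc L ≡ j′ ⊎ i + suc L ≡ j′ + (3 + k) →
                   j ≤ 2 + k → j′ ≤ 2 + k → Touches z j → Touches w j′ → ⊥
        conclude i j j′ i+L i+1+L j≤ j′≤ z-j w-j′ with parity j′
        ... | r , q , r≤1 , c with parity-unique p p′ r pp r≤1 w-out w-par (has-parity r q j′ c j′≤ w-j′)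
        ...   | refl =
          let Q , Qe    = same-parity q i j′ c i+1+L
              Q′ , Q′e  = previous-parity p p′ Q (i + L) pp Qe
              Q″ , Q″e  = extension-parity p′ Q′ i L j (subst (p′ ≤_) pp (m≤n+m p′ p)) (sym Q′e) i+L
          in exclusive p p′ pp z-out z-par (has-parity p′ Q″ j Q″e j≤ z-j)
      far : ∀ b → m ≤ b → ∃[ r ] 4 + (h + h) + r ≡ suc m → ⊥
      far b m≤b (r , e) =
        let y , d₁ , t , ¬deaf = avoiding-exit (3 + (h + h)) r (subst (λ m → Dist m w) length d)
                                   z-out (z-reach z-par) z-deaf (arc⇒≢ f)
        in continue b m≤b r e y d₁ t ¬deaf
        where
        length : 2 + m ≡ 3 + (h + h) + (2 + r)
        length = lin-≡ (sym e) (solve (h ∷ˡ m ∷ˡ r ∷ˡ []ˡ))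
        total : suc (3 + (h + h) + 1) ≡ k
        total = lin-≡ (sym k≡) (solve (h ∷ˡ k ∷ˡ []ˡ))
        p≤ : p + 0 ≤ 2 + k
        p≤ = lin (≤-reflexive pp) (1 + k + p′) (solve (k ∷ˡ p ∷ˡ p′ ∷ˡ []ˡ))
        continue : ∀ b → m ≤ b → ∀ r → 4 + (h + h) + r ≡ suc m → ∀ y → Dist (1 + r) y →
                   Trail D (Beside z) w y (3 + (h + h) + 1) → ¬ Deaf y → ⊥
        continue b m≤b r e y d₁ t ¬deaf = decide b m≤b r e d₁ (quasi-trail (from-z t) total)
          where
          y-par : HasParity p y
          y-par = has-parity p 0 (p + 0) refl p≤ (swap (quasi-trail
            (join (point {S = _≡ x (p + 0)} refl) (full-in p p′ 0 pp w-out w-par (dist-silent d) p≤) t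
              λ { refl (out , _) → out (p + 0 , s≤s p≤ , refl) })
            total))
          decide : ∀ b → m ≤ b → ∀ r → 4 + (h + h) + r ≡ suc m → Dist (1 + r) y → Adjacent D z y → ⊥
          decide b m≤b r e d₁ (inj₂ y→z) =
            [ no-arc-from p p′ pp (dist-out d₁) z-out y→z y-par z-par , ¬deaf ]′ (arc-from? y)
          decide b m≤b zero e d₁ (inj₁ z→y) = no-arc-to p p′ pp z-out (dist-out d₁) z→y z-par y-par (dist-1 d₁)
          decide zero m≤0 (suc r) e d₁ (inj₁ z→y) = lin-⊥ (m≤0 ⊹ ≤-reflexive e) (3 + h + h + r)
              (solve (h ∷ˡ m ∷ˡ r ∷ˡ []ˡ))
          decide (suc b) m≤b (suc r) e d₁ (inj₁ z→y) =
            deaf↛silent p p′ pp b r r≤b z y d₁ z-out z-deaf z→y z-par y-par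
            where
            r≤b : r ≤ b
            r≤b = lin (m≤b ⊹ ≤-reflexive e) (3 + h + h) (solve (b ∷ˡ h ∷ˡ m ∷ˡ r ∷ˡ []ˡ))
      case : 2 + m ≤ 4 + (h + h) ⊎ 4 + (h + h) < 2 + m → ⊥
      case (inj₁ m<) = near (≤⇒∃ m<)
      case (inj₂ <m) = far b m≤b (≤⇒∃ (≤-pred <m))

    independent : ∀ p p′ → p + p′ ≡ 1 → Out z → Out w → HasParity p z → HasParity p w → ¬ Arc D z w
    independent {z} {w} p p′ pp z-out w-out z-par w-par f with arc-from? z | distance w w-out
    ... | inj₁ from | _         = no-arc-from p p′ pp z-out w-out f z-par w-par from
    ... | inj₂ deaf | zero , d  = no-arc-to p p′ pp z-out w-out f z-par w-par (dist-1 d)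
    ... | inj₂ deaf | suc m , d = deaf↛silent p p′ pp m m ≤-refl z w d z-out deaf f z-par w-par

-- The geodesic of a shortest path

private
  module _ {V : Set} {D : Digraph V} where

    nth : ∀ {a b} → Walk D a b ℓ → ℕ → V
    nth [ a ]             _       = a
    nth (_∷_ {x = a} _ w) zero    = a
    nth (_ ∷ w)           (suc i) = nth w i

    nth-zero : ∀ {a b} (w : Walk D a b ℓ) → nth w 0 ≡ a
    nth-zero [ _ ]   = refl
    nth-zero (_ ∷ _) = refl

    nth-arc : ∀ {a b} (w : Walk D a b ℓ) i → i < ℓ → Arc D (nth w i) (nth w (suc i))
    nth-arc (e ∷ w) zero    _         = subst (Arc D _) (sym (nth-zero w)) e
    nth-arc (e ∷ w) (suc i) (s≤s i<ℓ) = nth-arc w i i<ℓ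

    nth∈vertices : ∀ {a b} (w : Walk D a b ℓ) i → i ≤ ℓ → nth w i ∈ᵛ vertices D w
    nth∈vertices [ _ ]   _       _         = here refl
    nth∈vertices (e ∷ w) zero    _         = here refl
    nth∈vertices (e ∷ w) (suc i) (s≤s i≤ℓ) = there (nth∈vertices w i i≤ℓ)

    append : ∀ {a b c} → Walk D a b m → Walk D b c n → Walk D a c (m + n)
    append [ _ ]   w′ = w′
    append (e ∷ w) w′ = e ∷ append w w′

    prefix : ∀ {a b} (w : Walk D a b ℓ) i → i ≤ ℓ → Walk D a (nth w i) i
    prefix w       zero    _         = subst (λ v → Walk D _ v 0) (sym (nth-zero w)) [ _ ]
    prefix (e ∷ w) (suc i) (s≤s i≤ℓ) = e ∷ prefix w i i≤ℓ

    suffix : ∀ {a b} (w : Walk D a b ℓ) i r → i + r ≡ ℓ → Walk D (nth w i) b r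
    suffix w       zero    r refl = subst (λ v → Walk D v _ r) (sym (nth-zero w)) w
    suffix (e ∷ w) (suc i) r eq   = suffix w i r (suc-injective eq)

-- Splicing a walk from x_i to x_j between the initial part of P up to x_i and its final part from
-- x_j gives a walk from u to v. It contains a path that is no longer, and minimality of P bounds
-- its length.
geodesic : ∀ {n k} {D : Digraph (Fin n)} {u v} → QuasiTransitive D k →
           (P : Path D u v (2 + k)) → IsShortest D P → Geodesic D k
geodesic {k = k} {D} {u} {v} quasi (path w _) shortest = record
  { vertex = nth w
  ; step   = nth-arc w
  ; short  = λ i j i≤ j≤ w′ → shortcut i j i≤ w′ (≤⇒∃ j≤)
  ; quasi  = quasi
  }
  where
  shortcut : ∀ i j {ℓ} → i ≤ 2 + k → Walk D (nth w i) (nth w j) ℓ → ∃[ r ] j + r ≡ 2 + k → j ≤ i + ℓ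
  shortcut i j {ℓ} i≤ w′ (r , e) =
    let m , m≤ , P = walk⇒path (append (prefix w i i≤) (append w′ (suffix w j r e)))
    in bound (≤-trans (shortest P) m≤)
    where
    bound : 2 + k ≤ i + (ℓ + r) → j ≤ i + ℓ
    bound N≤ = lin (N≤ ⊹ ≤-reflexive e) 0 (solve (i ∷ˡ j ∷ˡ k ∷ˡ r ∷ˡ ℓ ∷ˡ []ˡ))

odd≥5 : ∀ {k} → 5 ≤ k → 2 ∤ k → ∃[ h ] k ≡ 5 + (h + h)
odd≥5 {k} 5≤k 2∤k with parity k
... | 0 , q , _ , refl = ⊥-elim (2∤k (divides q (trans (cong (q +_) (sym (+-identityʳ q))) (*-comm 2 q))))
... | 1 , 0 , _ , refl = ⊥-elim (1+n≰n (≤-trans (s≤s (s≤s z≤n)) 5≤k))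
... | 1 , 1 , _ , refl = ⊥-elim (1+n≰n (≤-trans (s≤s (s≤s (s≤s (s≤s z≤n)))) 5≤k))
... | 1 , suc (suc h) , _ , refl = h , cong (3 +_) (trans (+-suc h (suc h)) (cong suc (+-suc h h)))
... | suc (suc _) , _ , s≤s () , _

theorem2p15 : ∀ (k : ℕ) → 5 ≤ k → 2 ∤ k →
    ∀ {n} (D : Digraph (Fin n)) → Strong D → QuasiTransitive D k →
    (∃[ m ] IsDiameter D m × k + 2 ≤ m) →
    ∀ (u v : Fin n) → IsDistance D u v (k + 2) →
    ∀ {ℓ} (P : Path D u v ℓ) → IsShortest D P →
    Semicomplete (induced D (∁ (VertexSet D P)))
    ⊎ SemicompleteBipartite (induced D (∁ (VertexSet D P)))
    ⊎ Empty (induced D (∁ (VertexSet D P)))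
theorem2p15 k 5≤k 2∤k {n} D strong quasi _ u v (Q , Q-shortest) {ℓ} P P-shortest
  -- P and the path that witnesses the distance are both shortest, so P has k + 2 arcs.
  with trans (≤-antisym (P-shortest Q) (Q-shortest P)) (+-comm k 2) | odd≥5 5≤k 2∤k
... | refl | h , k≡ = dichotomy world
  where
  connected : ∀ a b → ∃[ ℓ ] Walk D a b ℓ
  connected a b = let ℓ , R = strong a b in ℓ , Path.walk R
  open Structure h k≡ (geodesic quasi P P-shortest) connected
  off-path : ∀ (a : Refinement (Fin n) (∁ (VertexSet D P))) → Out (value a)
  off-path (a , [ a∉P ]) (m , m< , refl) = ⊥-elim-irr (a∉P (nth∈vertices (Path.walk P) m (≤-pred m<)))
  dichotomy : World → Semicomplete (induced D (∁ (VertexSet D P)))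
                    ⊎ SemicompleteBipartite (induced D (∁ (VertexSet D P)))
                    ⊎ Empty (induced D (∁ (VertexSet D P)))
  dichotomy (inj₁ mixed) = inj₁ λ a b a≢b →
    opposite-adjacent 0 1 refl (off-path a) (off-path b) (λ eq → a≢b (value-injective eq))
      (proj₁ (mixed _ (off-path a))) (proj₂ (mixed _ (off-path b)))
  -- One side may be empty, and then the remainder has no arcs.
  dichotomy (inj₂ unmixed) = inj₂ (inj₁ record
    { X           = λ a → HasParity 0 (value a)
    ; Y           = λ a → HasParity 1 (value a)
    ; cover       = λ a → attached (off-path a)
    ; disjoint    = λ {a} even odd → unmixed _ (off-path a) (even , odd)
    ; noArcInX    = λ {a} {b} even-a even-b → independent 0 1 refl (off-path a) (off-path b) even-a even-b
    ; noArcInY    = λ {a} {b} odd-a odd-b → independent 1 0 refl (off-path a) (off-path b) odd-a odd-b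
    ; allAdjacent = λ {a} {b} even odd → opposite-adjacent 0 1 refl (off-path a) (off-path b)
        (λ { refl → unmixed _ (off-path a) (even , odd) }) even odd
    })
    where open Unmixed unmixed
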